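{- Let $p$ be an odd prime and $m\geq 1$ be an integer. Then $$(q^{mp+1};q)_{p-1}-q^{mp(p-1)/2}(q;q)_{p-1}\equiv\frac{m(m+1)(p^2-1)p}{24}(1-q)^2[p]_q^2 \pmod{[p]_q^3}.$$
   Context: Here $q$ is an indeterminate. The $q$-number is $[n]_q=\frac{1-q^n}{1-q}=1+q+\cdots+q^{n-1}$, and the $q$-shifted factorial is $(A;q)_n=(1-A)(1-Aq)\cdots(1-Aq^{n-1})$. For polynomials $A,B,C$ in $\mathbb{Q}[q]$, $A\equiv B \pmod{C}$ means that $C$ divides $A-B$ in $\mathbb{Q}[q]$ (for $A,B$ with integer coefficients this is the same as divisibility in $\mathbb{Z}[q]$ when $C$ is a power of the monic polynomial $[p]_q$). -}

module Defs where

open import Algebra.Bundles using (CommutativeRing; CommutativeSemigroup; Semiring)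
open import Data.Fin.Base using (toℕ)
open import Data.List.Base using (List; []; _∷_; map)
open import Data.Nat.Base as ℕ using (ℕ; zero; suc)
open import Data.Product.Base using (_,_)
open import Data.Rational.Base as ℚ using (ℚ; 0ℚ; 1ℚ)
import Data.Rational.Properties as ℚ
open import Level using (0ℓ)
open import Relation.Binary.Bundles using (Setoid)
open import Relation.Binary.Structures using (IsEquivalence)
import Relation.Binary.PropositionalEquality as ≡
open ≡ using (_≡_)

infix  4 _≈_
infixl 6 _+_
infixl 7 _*_ _·_
infix  8 -_

-- Coefficient lists, constant term first.  Trailing zeros are allowed, so
-- equality of polynomials is _≈_ rather than _≡_.

ℚ[q] : Set
ℚ[q] = List ℚ

coeff : ℚ[q] → ℕ → ℚ
coeff []      _       = 0ℚ
coeff (a ∷ f) zero    = a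
coeff (a ∷ f) (suc n) = coeff f n

record _≈_ (f g : ℚ[q]) : Set where
  constructor mk≈
  field coeff-≡ : ∀ n → coeff f n ≡ coeff g n

open _≈_ public

0# : ℚ[q]
0# = []

const : ℚ → ℚ[q]
const a = a ∷ []

1# : ℚ[q]
1# = const 1ℚ

q : ℚ[q]
q = 0ℚ ∷ 1ℚ ∷ []

_+_ : ℚ[q] → ℚ[q] → ℚ[q]
[]      + g       = g
(a ∷ f) + []      = a ∷ f
(a ∷ f) + (b ∷ g) = a ℚ.+ b ∷ f + g

-_ : ℚ[q] → ℚ[q]
-_ = map (ℚ.-_)

_·_ : ℚ → ℚ[q] → ℚ[q]
a · f = map (a ℚ.*_) f

_*_ : ℚ[q] → ℚ[q] → ℚ[q]
[]      * g = []
(a ∷ f) * g = a · g + (0ℚ ∷ f * g)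

coeff-+ : ∀ f g n → coeff (f + g) n ≡ coeff f n ℚ.+ coeff g n
coeff-+ []      g       n       = ≡.sym (ℚ.+-identityˡ _)
coeff-+ (a ∷ f) []      n       = ≡.sym (ℚ.+-identityʳ _)
coeff-+ (a ∷ f) (b ∷ g) zero    = ≡.refl
coeff-+ (a ∷ f) (b ∷ g) (suc n) = coeff-+ f g n

coeff-neg : ∀ f n → coeff (- f) n ≡ ℚ.- coeff f n
coeff-neg []      n       = ≡.refl
coeff-neg (a ∷ f) zero    = ≡.refl
coeff-neg (a ∷ f) (suc n) = coeff-neg f n

coeff-· : ∀ a f n → coeff (a · f) n ≡ a ℚ.* coeff f n
coeff-· a []      n       = ≡.sym (ℚ.*-zeroʳ a)
coeff-· a (b ∷ f) zero    = ≡.refl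
coeff-· a (b ∷ f) (suc n) = coeff-· a f n

≈-isEquivalence : IsEquivalence _≈_
≈-isEquivalence = record
  { refl  = mk≈ λ _ → ≡.refl
  ; sym   = λ e → mk≈ λ n → ≡.sym (coeff-≡ e n)
  ; trans = λ e e′ → mk≈ λ n → ≡.trans (coeff-≡ e n) (coeff-≡ e′ n)
  }

≈-setoid : Setoid 0ℓ 0ℓ
≈-setoid = record { isEquivalence = ≈-isEquivalence }

open IsEquivalence ≈-isEquivalence using (refl; sym; trans)

+-cong : ∀ {f f′ g g′} → f ≈ f′ → g ≈ g′ → f + g ≈ f′ + g′
+-cong {f} {f′} {g} {g′} e e′ = mk≈ λ n → begin
  coeff (f + g) n              ≡⟨ coeff-+ f g n ⟩
  coeff f n ℚ.+ coeff g n      ≡⟨ ≡.cong₂ ℚ._+_ (coeff-≡ e n) (coeff-≡ e′ n) ⟩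
  coeff f′ n ℚ.+ coeff g′ n    ≡⟨ coeff-+ f′ g′ n ⟨
  coeff (f′ + g′) n            ∎
  where open ≡.≡-Reasoning

+-assoc : ∀ f g h → (f + g) + h ≈ f + (g + h)
+-assoc f g h = mk≈ λ n → begin
  coeff ((f + g) + h) n                        ≡⟨ coeff-+ (f + g) h n ⟩
  coeff (f + g) n ℚ.+ coeff h n                ≡⟨ ≡.cong (ℚ._+ coeff h n) (coeff-+ f g n) ⟩
  (coeff f n ℚ.+ coeff g n) ℚ.+ coeff h n      ≡⟨ ℚ.+-assoc (coeff f n) (coeff g n) (coeff h n) ⟩
  coeff f n ℚ.+ (coeff g n ℚ.+ coeff h n)      ≡⟨ ≡.cong (coeff f n ℚ.+_) (coeff-+ g h n) ⟨
  coeff f n ℚ.+ coeff (g + h) n                ≡⟨ coeff-+ f (g + h) n ⟨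
  coeff (f + (g + h)) n                        ∎
  where open ≡.≡-Reasoning

+-comm : ∀ f g → f + g ≈ g + f
+-comm f g = mk≈ λ n → begin
  coeff (f + g) n            ≡⟨ coeff-+ f g n ⟩
  coeff f n ℚ.+ coeff g n    ≡⟨ ℚ.+-comm (coeff f n) (coeff g n) ⟩
  coeff g n ℚ.+ coeff f n    ≡⟨ coeff-+ g f n ⟨
  coeff (g + f) n            ∎
  where open ≡.≡-Reasoning

+-identityˡ : ∀ f → 0# + f ≈ f
+-identityˡ f = refl

+-identityʳ : ∀ f → f + 0# ≈ f
+-identityʳ f = +-comm f 0#

-‿cong : ∀ {f g} → f ≈ g → - f ≈ - g
-‿cong {f} {g} e = mk≈ λ n →
  ≡.trans (coeff-neg f n) (≡.trans (≡.cong ℚ.-_ (coeff-≡ e n)) (≡.sym (coeff-neg g n)))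

-‿inverseˡ : ∀ f → - f + f ≈ 0#
-‿inverseˡ f = mk≈ λ n → begin
  coeff (- f + f) n              ≡⟨ coeff-+ (- f) f n ⟩
  coeff (- f) n ℚ.+ coeff f n    ≡⟨ ≡.cong (ℚ._+ coeff f n) (coeff-neg f n) ⟩
  ℚ.- coeff f n ℚ.+ coeff f n    ≡⟨ ℚ.+-inverseˡ (coeff f n) ⟩
  0ℚ                             ∎
  where open ≡.≡-Reasoning

-‿inverseʳ : ∀ f → f + - f ≈ 0#
-‿inverseʳ f = trans (+-comm f (- f)) (-‿inverseˡ f)

·-cong : ∀ a {f g} → f ≈ g → a · f ≈ a · g
·-cong a {f} {g} e = mk≈ λ n →
  ≡.trans (coeff-· a f n) (≡.trans (≡.cong (a ℚ.*_) (coeff-≡ e n)) (≡.sym (coeff-· a g n)))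

·-distribˡ : ∀ a f g → a · (f + g) ≈ a · f + a · g
·-distribˡ a f g = mk≈ λ n → begin
  coeff (a · (f + g)) n                      ≡⟨ coeff-· a (f + g) n ⟩
  a ℚ.* coeff (f + g) n                      ≡⟨ ≡.cong (a ℚ.*_) (coeff-+ f g n) ⟩
  a ℚ.* (coeff f n ℚ.+ coeff g n)            ≡⟨ ℚ.*-distribˡ-+ a (coeff f n) (coeff g n) ⟩
  a ℚ.* coeff f n ℚ.+ a ℚ.* coeff g n        ≡⟨ ≡.cong₂ ℚ._+_ (coeff-· a f n) (coeff-· a g n) ⟨
  coeff (a · f) n ℚ.+ coeff (a · g) n        ≡⟨ coeff-+ (a · f) (a · g) n ⟨
  coeff (a · f + a · g) n                    ∎
  where open ≡.≡-Reasoning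

·-distribʳ : ∀ f a b → (a ℚ.+ b) · f ≈ a · f + b · f
·-distribʳ f a b = mk≈ λ n → begin
  coeff ((a ℚ.+ b) · f) n                    ≡⟨ coeff-· (a ℚ.+ b) f n ⟩
  (a ℚ.+ b) ℚ.* coeff f n                    ≡⟨ ℚ.*-distribʳ-+ (coeff f n) a b ⟩
  a ℚ.* coeff f n ℚ.+ b ℚ.* coeff f n        ≡⟨ ≡.cong₂ ℚ._+_ (coeff-· a f n) (coeff-· b f n) ⟨
  coeff (a · f) n ℚ.+ coeff (b · f) n        ≡⟨ coeff-+ (a · f) (b · f) n ⟨
  coeff (a · f + b · f) n                    ∎
  where open ≡.≡-Reasoning

·-assoc : ∀ a b f → (a ℚ.* b) · f ≈ a · (b · f)
·-assoc a b f = mk≈ λ n → begin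
  coeff ((a ℚ.* b) · f) n      ≡⟨ coeff-· (a ℚ.* b) f n ⟩
  a ℚ.* b ℚ.* coeff f n        ≡⟨ ℚ.*-assoc a b (coeff f n) ⟩
  a ℚ.* (b ℚ.* coeff f n)      ≡⟨ ≡.cong (a ℚ.*_) (coeff-· b f n) ⟨
  a ℚ.* coeff (b · f) n        ≡⟨ coeff-· a (b · f) n ⟨
  coeff (a · (b · f)) n        ∎
  where open ≡.≡-Reasoning

·-identity : ∀ f → 1ℚ · f ≈ f
·-identity f = mk≈ λ n → ≡.trans (coeff-· 1ℚ f n) (ℚ.*-identityˡ (coeff f n))

·-zero : ∀ f → 0ℚ · f ≈ 0#
·-zero f = mk≈ λ n → ≡.trans (coeff-· 0ℚ f n) (ℚ.*-zeroˡ (coeff f n))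

∷-cong : ∀ {a b f g} → a ≡ b → f ≈ g → a ∷ f ≈ b ∷ g
∷-cong e e′ = mk≈ λ { zero → e ; (suc n) → coeff-≡ e′ n }

0∷0# : 0ℚ ∷ 0# ≈ 0#
0∷0# = mk≈ λ { zero → ≡.refl ; (suc n) → ≡.refl }

+-commutativeSemigroup : CommutativeSemigroup 0ℓ 0ℓ
+-commutativeSemigroup = record
  { Carrier = ℚ[q]
  ; _≈_ = _≈_
  ; _∙_ = _+_
  ; isCommutativeSemigroup = record
    { isSemigroup = record
      { isMagma = record { isEquivalence = ≈-isEquivalence ; ∙-cong = +-cong }
      ; assoc   = +-assoc
      }
    ; comm = +-comm
    }
  }

open import Algebra.Properties.CommutativeSemigroup +-commutativeSemigroup
  using (interchange; x∙yz≈y∙xz)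
import Relation.Binary.Reasoning.Setoid as ≈-Reasoning

private
  module R = ≈-Reasoning ≈-setoid

0∷-distrib : ∀ f g → 0ℚ ∷ (f + g) ≈ (0ℚ ∷ f) + (0ℚ ∷ g)
0∷-distrib f g = ∷-cong (≡.sym (ℚ.+-identityˡ 0ℚ)) refl

*-congˡ : ∀ f {g g′} → g ≈ g′ → f * g ≈ f * g′
*-congˡ []      e = refl
*-congˡ (a ∷ f) e = +-cong (·-cong a e) (∷-cong ≡.refl (*-congˡ f e))

*-zeroʳ : ∀ f → f * 0# ≈ 0#
*-zeroʳ []      = refl
*-zeroʳ (a ∷ f) = trans (∷-cong ≡.refl (*-zeroʳ f)) 0∷0#

*-∷ : ∀ f b g → f * (b ∷ g) ≈ b · f + (0ℚ ∷ f * g)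
*-∷ []      b g = sym 0∷0#
*-∷ (a ∷ f) b g = ∷-cong (≡.cong (ℚ._+ 0ℚ) (ℚ.*-comm a b)) (begin
  a · g + f * (b ∷ g)              ≈⟨ +-cong refl (*-∷ f b g) ⟩
  a · g + (b · f + (0ℚ ∷ f * g))   ≈⟨ x∙yz≈y∙xz (a · g) (b · f) (0ℚ ∷ f * g) ⟩
  b · f + (a · g + (0ℚ ∷ f * g))   ∎)
  where open R

*-comm : ∀ f g → f * g ≈ g * f
*-comm []      g = sym (*-zeroʳ g)
*-comm (a ∷ f) g = trans (+-cong refl (∷-cong ≡.refl (*-comm f g))) (sym (*-∷ g a f))

*-cong : ∀ {f f′ g g′} → f ≈ f′ → g ≈ g′ → f * g ≈ f′ * g′
*-cong {f} {f′} {g} {g′} e e′ = begin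
  f * g     ≈⟨ *-congˡ f e′ ⟩
  f * g′    ≈⟨ *-comm f g′ ⟩
  g′ * f    ≈⟨ *-congˡ g′ e ⟩
  g′ * f′   ≈⟨ *-comm g′ f′ ⟩
  f′ * g′   ∎
  where open R

*-distribˡ : ∀ f g h → f * (g + h) ≈ f * g + f * h
*-distribˡ []      g h = refl
*-distribˡ (a ∷ f) g h = begin
  a · (g + h) + (0ℚ ∷ f * (g + h))
    ≈⟨ +-cong (·-distribˡ a g h) (trans (∷-cong ≡.refl (*-distribˡ f g h)) (0∷-distrib (f * g) (f * h))) ⟩
  (a · g + a · h) + ((0ℚ ∷ f * g) + (0ℚ ∷ f * h))
    ≈⟨ interchange (a · g) (a · h) (0ℚ ∷ f * g) (0ℚ ∷ f * h) ⟩
  (a · g + (0ℚ ∷ f * g)) + (a · h + (0ℚ ∷ f * h))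
    ∎
  where open R

*-distribʳ : ∀ f g h → (g + h) * f ≈ g * f + h * f
*-distribʳ f g h = trans (*-comm (g + h) f)
  (trans (*-distribˡ f g h) (+-cong (*-comm f g) (*-comm f h)))

·-*-assoc : ∀ a f g → (a · f) * g ≈ a · (f * g)
·-*-assoc a []      g = refl
·-*-assoc a (b ∷ f) g = begin
  (a ℚ.* b) · g + (0ℚ ∷ (a · f) * g)
    ≈⟨ +-cong (·-assoc a b g) (∷-cong (≡.sym (ℚ.*-zeroʳ a)) (·-*-assoc a f g)) ⟩
  a · (b · g) + a · (0ℚ ∷ f * g)
    ≈⟨ ·-distribˡ a (b · g) (0ℚ ∷ f * g) ⟨
  a · (b · g + (0ℚ ∷ f * g))
    ∎
  where open R

0∷-* : ∀ f g → (0ℚ ∷ f) * g ≈ 0ℚ ∷ f * g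
0∷-* f g = +-cong (·-zero g) refl

*-assoc : ∀ f g h → (f * g) * h ≈ f * (g * h)
*-assoc []      g h = refl
*-assoc (a ∷ f) g h = begin
  (a · g + (0ℚ ∷ f * g)) * h           ≈⟨ *-distribʳ h (a · g) (0ℚ ∷ f * g) ⟩
  (a · g) * h + (0ℚ ∷ f * g) * h       ≈⟨ +-cong (·-*-assoc a g h) (0∷-* (f * g) h) ⟩
  a · (g * h) + (0ℚ ∷ (f * g) * h)     ≈⟨ +-cong refl (∷-cong ≡.refl (*-assoc f g h)) ⟩
  a · (g * h) + (0ℚ ∷ f * (g * h))     ∎
  where open R

*-identityˡ : ∀ f → 1# * f ≈ f
*-identityˡ f = begin
  1ℚ · f + (0ℚ ∷ 0#)   ≈⟨ +-cong (·-identity f) 0∷0# ⟩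
  f + 0#               ≈⟨ +-identityʳ f ⟩
  f                    ∎
  where open R

*-identityʳ : ∀ f → f * 1# ≈ f
*-identityʳ f = trans (*-comm f 1#) (*-identityˡ f)

ℚ[q]-commutativeRing : CommutativeRing 0ℓ 0ℓ
ℚ[q]-commutativeRing = record
  { Carrier = ℚ[q]
  ; _≈_ = _≈_
  ; _+_ = _+_
  ; _*_ = _*_
  ; -_  = -_
  ; 0#  = 0#
  ; 1#  = 1#
  ; isCommutativeRing = record
    { isRing = record
      { +-isAbelianGroup = record
        { isGroup = record
          { isMonoid = record
            { isSemigroup = CommutativeSemigroup.isSemigroup +-commutativeSemigroup
            ; identity    = +-identityˡ , +-identityʳ
            }
          ; inverse = -‿inverseˡ , -‿inverseʳ
          ; ⁻¹-cong = -‿cong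
          }
        ; comm = +-comm
        }
      ; *-cong     = *-cong
      ; *-assoc    = *-assoc
      ; *-identity = *-identityˡ , *-identityʳ
      ; distrib    = *-distribˡ , *-distribʳ
      }
    ; *-comm = *-comm
    }
  }

open CommutativeRing ℚ[q]-commutativeRing public using (_-_)
open import Algebra.Definitions.RawSemiring
  (Semiring.rawSemiring (CommutativeRing.semiring ℚ[q]-commutativeRing)) public
  using (_^_; _∣_; sum; product)

infix 4 _≡_[mod_]
infix 9 ⟨_⨾q⟩_

_≡_[mod_] : ℚ[q] → ℚ[q] → ℚ[q] → Set
A ≡ B [mod C ] = C ∣ (A - B)

[_]q : ℕ → ℚ[q]
[ n ]q = sum {n} λ i → q ^ toℕ i

⟨_⨾q⟩_ : ℚ[q] → ℕ → ℚ[q]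
⟨ A ⨾q⟩ n = product {n} λ i → 1# - A * q ^ toℕ i

[n]q-quotient : ∀ n → (1# - q) * [ n ]q ≈ 1# - q ^ n
[n]q-quotient zero    = trans (*-zeroʳ (1# - q)) (sym (-‿inverseʳ 1#))
[n]q-quotient (suc n) = begin
  (1# - q) * (1# + sum {n} λ i → q * q ^ toℕ i)
    ≈⟨ *-cong {1# - q} refl (+-cong {1#} refl (*-distribˡ-sum {n} q λ i → q ^ toℕ i)) ⟨
  (1# - q) * (1# + q * [ n ]q)
    ≈⟨ *-distribˡ (1# - q) 1# (q * [ n ]q) ⟩
  (1# - q) * 1# + (1# - q) * (q * [ n ]q)
    ≈⟨ +-cong (*-identityʳ (1# - q)) (x*yz≈y*xz (1# - q) q [ n ]q) ⟩
  (1# - q) + q * ((1# - q) * [ n ]q)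
    ≈⟨ +-cong {1# - q} refl (*-cong {q} refl ([n]q-quotient n)) ⟩
  (1# - q) + q * (1# - q ^ n)
    ≈⟨ +-cong {1# - q} refl (x[y-z]≈xy-xz q 1# (q ^ n)) ⟩
  (1# - q) + (q * 1# - q ^ suc n)
    ≈⟨ +-cong {1# - q} refl (+-cong (*-identityʳ q) (refl { - (q ^ suc n)})) ⟩
  (1# - q) + (q - q ^ suc n)
    ≈⟨ +-assoc 1# (- q) (q - q ^ suc n) ⟩
  1# + (- q + (q - q ^ suc n))
    ≈⟨ +-cong {1#} refl (+-assoc (- q) q (- (q ^ suc n))) ⟨
  1# + ((- q + q) - q ^ suc n)
    ≈⟨ +-cong {1#} refl (+-cong (-‿inverseˡ q) (refl { - (q ^ suc n)})) ⟩
  1# - q ^ suc n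
    ∎
  where
  open R
  open CommutativeRing ℚ[q]-commutativeRing using (ring; semiring; *-commutativeSemigroup)
  open import Algebra.Properties.Ring ring using (x[y-z]≈xy-xz)
  open import Algebra.Properties.Semiring.Sum semiring using (*-distribˡ-sum)
  open import Algebra.Properties.CommutativeSemigroup *-commutativeSemigroup
    using () renaming (x∙yz≈y∙xz to x*yz≈y*xz)

{-# OPTIONS --safe #-}

-- Put p = 2h + 1, x = q^{mp} and D = (1 - x)(1 - x q^p).  Pairing the factors
-- with exponents k and p - k,
--   (1 - x q^k)(1 - x q^{p-k}) = x b_k + D,   b_k = (1 - q^k)(1 - q^{p-k}),
-- gives ∏ (1 - x q^k) ≡ x^h ∏ b_k + D x^{h-1} e (mod D²), where e = Σ_j ∏_{i≠j} b_i.
-- As 1 - q^p = (1 - q) [p], D is divisible by (1 - q)² [p]², with quotient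
-- ≡ m(m+1) modulo [p], so it remains to show 24 e ≡ p(p² - 1) modulo [p].
-- Modulo [p] each 1 - q^k (0 < k < p) is a unit, and the q-binomial theorem
-- becomes ∏ (1 - x q^k) = 1 + x + ⋯ + x^{p-1}.  This holds for x in any algebra
-- over ℚ[q]/[p]; at x = 1 + t with t³ = 0, where D = t², the coefficients of 1
-- and t² give ∏ b_k = p and e = C(p,3) - p C(h,2).
module Submission where

open import Algebra.Bundles using (CommutativeMonoid; CommutativeRing; Semiring)
open import Algebra.Definitions.RawMagma using (_,_)
import Algebra.Definitions.RawSemiring as RawSemiringDefinitions
open import Algebra.Morphism.Structures using (IsRingHomomorphism)
import Algebra.Properties.CommutativeMonoid.Sum as CommutativeMonoidSum
open import Algebra.Solver.Ring.AlmostCommutativeRing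
  using (_-Raw-AlmostCommutative⟶_; fromCommutativeRing)
open import Data.Fin.Base using (toℕ)
open import Data.Fin.Properties using (toℕ-inject₁; toℕ-fromℕ; toℕ<n)
open import Data.Integer.Base as ℤ using (ℤ; +_; -[1+_])
import Data.Integer.Properties as ℤ
open import Data.Maybe.Base using (map)
open import Data.Nat.Base as ℕ using (ℕ; zero; suc; _∸_)
open import Data.Nat.Coprimality using (prime⇒coprime; coprime-Bézout)
open import Data.Nat.DivMod using (m*n/n≡m)
open import Data.Nat.Divisibility as ℕ using ()
open import Data.Nat.GCD using (module Bézout)
open import Data.Nat.Primality using (Prime)
import Data.Nat.Properties as ℕ
open import Data.Nat.Solver using (module +-*-Solver)
open import Data.Product.Base using (∃; _,_)
open import Data.Rational.Base as ℚ using (1ℚ)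
import Data.Rational.Properties as ℚ
open import Data.Rational.Unnormalised.Base as ℚᵘ using (mkℚᵘ; *≡*)
import Data.Rational.Unnormalised.Properties as ℚᵘ
import Data.Sign.Base as Sign
open import Level using (_⊔_)
import Relation.Binary.PropositionalEquality as ≡
open ≡ using (_≡_)
import Relation.Binary.Reasoning.Setoid as SetoidReasoning
open import Relation.Nullary.Decidable.Core using (dec⇒maybe)
open import Relation.Nullary.Negation.Core using (contradiction)

-- Integer-coefficient identities in commutative rings

module IntegerSolver {c ℓ} (R : CommutativeRing c ℓ) where

  open CommutativeRing R hiding (zero)
  open import Algebra.Definitions.RawSemiring (Semiring.rawSemiring semiring) using (_×′_)
  open import Algebra.Properties.Semiring.Mult.TCOptimised semiring
    using (1+×; ×-homo-+; ×1-homo-*)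
  open import Algebra.Properties.Ring ring
  open import Algebra.Properties.AbelianGroup +-abelianGroup
  open import Algebra.Properties.CommutativeSemigroup +-commutativeSemigroup
    using (interchange)
  open import Relation.Binary.Reasoning.Setoid setoid

  -- Equality of integer coefficients is decidable, so the solver also works in rings that come with
  -- no decision procedure, such as quotients. The multiple `_×′_` is chosen because `1 ×′ 1#`
  -- reduces to `1#`, so that `:1` denotes `1#` itself.
  ⟦_⟧ℤ : ℤ → Carrier
  ⟦ + n ⟧ℤ      = n ×′ 1#
  ⟦ -[1+ n ] ⟧ℤ = - (suc n ×′ 1#)

  neg-homo : ∀ i → ⟦ ℤ.- i ⟧ℤ ≈ - ⟦ i ⟧ℤ
  neg-homo (+ zero)    = sym ε⁻¹≈ε
  neg-homo (+ suc n)   = refl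
  neg-homo (-[1+ n ])  = sym (⁻¹-involutive _)

  ⊖-homo : ∀ m n → ⟦ m ℤ.⊖ n ⟧ℤ ≈ m ×′ 1# - n ×′ 1#
  ⊖-homo zero zero = sym (-‿inverseʳ 0#)
  ⊖-homo zero (suc n) = sym (+-identityˡ _)
  ⊖-homo (suc m) zero = sym (trans (+-congˡ ε⁻¹≈ε) (+-identityʳ _))
  ⊖-homo (suc m) (suc n) = begin
    ⟦ suc m ℤ.⊖ suc n ⟧ℤ
      ≡⟨ ≡.cong ⟦_⟧ℤ (ℤ.[1+m]⊖[1+n]≡m⊖n m n) ⟩
    ⟦ m ℤ.⊖ n ⟧ℤ
      ≈⟨ ⊖-homo m n ⟩
    m ×′ 1# - n ×′ 1#
      ≈⟨ +-identityˡ _ ⟨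
    0# + (m ×′ 1# - n ×′ 1#)
      ≈⟨ +-congʳ (-‿inverseʳ 1#) ⟨
    (1# - 1#) + (m ×′ 1# - n ×′ 1#)
      ≈⟨ interchange _ _ _ _ ⟩
    (1# + m ×′ 1#) + (- 1# - n ×′ 1#)
      ≈⟨ +-congˡ (⁻¹-∙-comm _ _) ⟩
    (1# + m ×′ 1#) - (1# + n ×′ 1#)
      ≈⟨ +-cong (1+× m 1#) (-‿cong (1+× n 1#)) ⟨
    suc m ×′ 1# - suc n ×′ 1#
      ∎

  +-homo : ∀ i j → ⟦ i ℤ.+ j ⟧ℤ ≈ ⟦ i ⟧ℤ + ⟦ j ⟧ℤ
  +-homo (+ m)      (+ n)      = ×-homo-+ 1# m n
  +-homo (+ m)      (-[1+ n ]) = ⊖-homo m (suc n)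
  +-homo (-[1+ m ]) (+ n)      = trans (⊖-homo n (suc m)) (+-comm _ _)
  +-homo (-[1+ m ]) (-[1+ n ]) = begin
    ⟦ -[1+ m ] ℤ.+ -[1+ n ] ⟧ℤ          ≡⟨ ≡.cong ⟦_⟧ℤ (ℤ.neg-distrib-+ (+ suc m) (+ suc n)) ⟨
    ⟦ ℤ.- (+ suc m ℤ.+ + suc n) ⟧ℤ      ≈⟨ neg-homo (+ suc m ℤ.+ + suc n) ⟩
    - ((suc m ℕ.+ suc n) ×′ 1#)         ≈⟨ -‿cong (×-homo-+ 1# (suc m) (suc n)) ⟩
    - (suc m ×′ 1# + suc n ×′ 1#)       ≈⟨ ⁻¹-∙-comm _ _ ⟨
    - (suc m ×′ 1#) - suc n ×′ 1#       ∎

  +◃-homo : ∀ n → ⟦ Sign.+ ℤ.◃ n ⟧ℤ ≈ n ×′ 1#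
  +◃-homo n = reflexive (≡.cong ⟦_⟧ℤ (ℤ.+◃n≡+n n))

  -◃-homo : ∀ n → ⟦ Sign.- ℤ.◃ n ⟧ℤ ≈ - (n ×′ 1#)
  -◃-homo n = trans (reflexive (≡.cong ⟦_⟧ℤ (ℤ.-◃n≡-n n))) (neg-homo (+ n))

  *-homo : ∀ i j → ⟦ i ℤ.* j ⟧ℤ ≈ ⟦ i ⟧ℤ * ⟦ j ⟧ℤ
  *-homo (+ m)      (+ n)      = trans (+◃-homo (m ℕ.* n)) (×1-homo-* m n)
  *-homo (+ m)      (-[1+ n ]) = trans (-◃-homo (m ℕ.* suc n))
    (trans (-‿cong (×1-homo-* m (suc n))) (-‿distribʳ-* _ _))
  *-homo (-[1+ m ]) (+ n)      = trans (-◃-homo (suc m ℕ.* n))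
    (trans (-‿cong (×1-homo-* (suc m) n)) (-‿distribˡ-* _ _))
  *-homo (-[1+ m ]) (-[1+ n ]) = begin
    (suc m ℕ.* suc n) ×′ 1#             ≈⟨ ×1-homo-* (suc m) (suc n) ⟩
    suc m ×′ 1# * suc n ×′ 1#           ≈⟨ ⁻¹-involutive _ ⟨
    - - (suc m ×′ 1# * suc n ×′ 1#)     ≈⟨ -‿cong (-‿distribʳ-* _ _) ⟩
    - (suc m ×′ 1# * - (suc n ×′ 1#))   ≈⟨ -‿distribˡ-* _ _ ⟩
    - (suc m ×′ 1#) * - (suc n ×′ 1#)   ∎

  homomorphism : ℤ.+-*-rawRing -Raw-AlmostCommutative⟶ fromCommutativeRing R
  homomorphism = record
    { ⟦_⟧    = ⟦_⟧ℤ
    ; +-homo = +-homo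
    ; *-homo = *-homo
    ; -‿homo = neg-homo
    ; 0-homo = refl
    ; 1-homo = refl
    }

  open import Algebra.Solver.Ring ℤ.+-*-rawRing (fromCommutativeRing R) homomorphism
    (λ i j → map (λ i≡j → reflexive (≡.cong ⟦_⟧ℤ i≡j)) (dec⇒maybe (i ℤ.≟ j)))
    public using (solve; _:=_; con; _:+_; _:*_; _:-_; :-_; Polynomial)

  :0 : ∀ {n} → Polynomial n
  :0 = con (+ 0)

  :1 : ∀ {n} → Polynomial n
  :1 = con (+ 1)

-- Splitting and folding finite sums and products

module FiniteSums {c ℓ} (M : CommutativeMonoid c ℓ) where

  open CommutativeMonoid M
  open import Algebra.Properties.CommutativeMonoid.Sum M
    using (sum; sum-init-last; sum-cong-≋; ∑-distrib-+)
  open import Algebra.Properties.CommutativeSemigroup commutativeSemigroup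
    using (x∙yz≈xz∙y)
  open import Relation.Binary.Reasoning.Setoid setoid

  sum-snoc : ∀ n (f : ℕ → Carrier) →
             sum {suc n} (λ i → f (toℕ i)) ≈ sum {n} (λ i → f (toℕ i)) ∙ f n
  sum-snoc n f = trans (sum-init-last {n} (λ i → f (toℕ i)))
    (∙-cong (sum-cong-≋ {n} λ i → reflexive (≡.cong f (toℕ-inject₁ i)))
            (reflexive (≡.cong f (toℕ-fromℕ n))))

  -- Folds the range in the middle: `i` meets its mirror image `2h - 1 - i`. The induction removes
  -- the outermost pair, and what remains is the fold of the shifted function.
  sum-pair : ∀ h (f : ℕ → Carrier) →
             sum {h ℕ.+ h} (λ i → f (toℕ i)) ≈
             sum {h} (λ i → f (toℕ i) ∙ f (h ℕ.+ h ∸ suc (toℕ i)))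
  sum-pair zero f = refl
  sum-pair (suc h) f rewrite ℕ.+-suc h h = begin
    f 0 ∙ sum {suc (h ℕ.+ h)} (λ i → f (suc (toℕ i)))
      ≈⟨ ∙-congˡ (sum-snoc (h ℕ.+ h) (λ i → f (suc i))) ⟩
    f 0 ∙ (sum {h ℕ.+ h} (λ i → f (suc (toℕ i))) ∙ f (suc (h ℕ.+ h)))
      ≈⟨ x∙yz≈xz∙y _ _ _ ⟩
    (f 0 ∙ f (suc (h ℕ.+ h))) ∙ sum {h ℕ.+ h} (λ i → f (suc (toℕ i)))
      ≈⟨ ∙-congˡ (sum-pair h (λ i → f (suc i))) ⟩
    (f 0 ∙ f (suc (h ℕ.+ h))) ∙ sum {h} (λ i → f (suc (toℕ i)) ∙ f (suc (h ℕ.+ h ∸ suc (toℕ i))))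
      -- The shift has to be absorbed into the truncated subtraction, which is legitimate since
      -- `suc (toℕ i)` is at most `h + h`.
      ≈⟨ ∙-congˡ (sum-cong-≋ {h} λ i → ∙-congˡ (reflexive (≡.cong f
           (≡.sym (ℕ.+-∸-assoc 1 (ℕ.≤-trans (toℕ<n i) (ℕ.m≤m+n h h))))))) ⟩
    (f 0 ∙ f (suc (h ℕ.+ h))) ∙ sum {h} (λ i → f (suc (toℕ i)) ∙ f (h ℕ.+ h ∸ toℕ i))
      ∎

-- Pairing of factors and q-binomial coefficients

module Products {c ℓ} (R : CommutativeRing c ℓ) where

  open CommutativeRing R hiding (zero)
  open import Algebra.Definitions.RawSemiring (Semiring.rawSemiring semiring)
    using (_^_; product; sum)
  open import Algebra.Properties.Semiring.Exp semiring using (^-homo-*; ^-congʳ)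
  import Algebra.Properties.CommutativeMonoid.Sum *-commutativeMonoid as Π
  open FiniteSums *-commutativeMonoid using ()
    renaming (sum-snoc to product-snoc; sum-pair to product-pair)
  open FiniteSums +-commutativeMonoid using (sum-snoc)
  import Algebra.Properties.Semiring.Sum semiring as Σ
  open IntegerSolver R
  open import Relation.Binary.Reasoning.Setoid setoid

  -- Σ_{j<h} ∏_{i≠j} b i
  e : ℕ → (ℕ → Carrier) → Carrier
  e zero    b = 0#
  e (suc h) b = product {h} (λ i → b (suc (toℕ i))) + b 0 * e h (λ i → b (suc i))

  -- For `h = 0` the powers of `x` on the two sides do not match, but `e zero b` is zero and both
  -- sides vanish.
  x*x^[h∸1]*e : ∀ x (h : ℕ) b → x * (x ^ (h ∸ 1) * e h b) ≈ x ^ h * e h b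
  x*x^[h∸1]*e x zero    b = trans (*-congˡ (zeroʳ _)) (trans (zeroʳ x) (sym (zeroʳ _)))
  x*x^[h∸1]*e x (suc h) b = sym (*-assoc _ _ _)

  -- The truncated h ∸ 1 is harmless at h = 0, where e h b = 0.
  product-expand : ∀ h (b : ℕ → Carrier) x D → ∃ λ r →
    product {h} (λ i → x * b (toℕ i) + D) ≈
    x ^ h * product {h} (λ i → b (toℕ i)) + D * (x ^ (h ∸ 1) * e h b + D * r)
  product-expand zero b x D = 0# ,
    solve 1 (λ D → :1 := :1 :* :1 :+ D :* (:1 :* :0 :+ D :* :0)) refl D
  product-expand (suc h) b x D with r , eq ← product-expand h (λ i → b (suc i)) x D = r′ , (begin
      (x * b 0 + D) * product {h} (λ i → x * b (suc (toℕ i)) + D)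
        ≈⟨ *-congˡ eq ⟩
      (x * b 0 + D) * (x ^ h * E + D * (x ^ (h ∸ 1) * e′ + D * r))
        ≈⟨ solve 7 (λ x b D X E Y r →
             (x :* b :+ D) :* (X :* E :+ D :* (Y :+ D :* r)) :=
             (x :* X) :* (b :* E) :+ D :* (X :* E :+ b :* (x :* Y) :+ D :* (Y :+ x :* b :* r :+ D :* r)))
             refl x (b 0) D (x ^ h) E (x ^ (h ∸ 1) * e′) r ⟩
      x ^ suc h * (b 0 * E) + D * (x ^ h * E + b 0 * (x * (x ^ (h ∸ 1) * e′)) + D * r′)
        ≈⟨ +-congˡ (*-congˡ (+-congʳ (trans (+-congˡ (*-congˡ (x*x^[h∸1]*e x h b′)))
             (solve 4 (λ X E b e → X :* E :+ b :* (X :* e) := X :* (E :+ b :* e)) refl (x ^ h) E (b 0) e′)))) ⟩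
      x ^ suc h * (b 0 * E) + D * (x ^ h * (E + b 0 * e′) + D * r′)
        ∎)
    where
    b′ : ℕ → Carrier
    b′ i = b (suc i)
    E  = product {h} (λ i → b′ (toℕ i))
    e′ = e h b′
    -- Everything of order `D * D`: the linear term of the tail multiplied by `D`, and the products
    -- of both summands of the first factor with the remainder of the tail.
    r′ = x ^ (h ∸ 1) * e′ + x * b 0 * r + D * r

  module Pairing (q : Carrier) (h : ℕ) where

    -- b i pairs the exponents i + 1 and p - (i + 1), where p = 2h + 1.
    b : ℕ → Carrier
    b i = (1# - q * q ^ i) * (1# - q * q ^ (h ℕ.+ h ∸ suc i))

    D : Carrier → Carrier
    D x = (1# - x) * (1# - x * q ^ suc (h ℕ.+ h))

    -- The two exponents of a pair add up to `p`, which is why the correction `D x` is the same for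
    -- every pair.
    exponents : ∀ {i} → i ℕ.< h → suc i ℕ.+ suc (h ℕ.+ h ∸ suc i) ≡ suc (h ℕ.+ h)
    exponents {i} i<h = ≡.trans (ℕ.+-suc (suc i) _)
      (≡.cong suc (ℕ.m+[n∸m]≡n (ℕ.≤-trans i<h (ℕ.m≤m+n h h))))

    product-1-xq : ∀ x → product {h ℕ.+ h} (λ i → 1# - x * q * q ^ toℕ i) ≈
                         product {h} (λ i → x * b (toℕ i) + D x)
    product-1-xq x = trans (product-pair h (λ i → 1# - x * q * q ^ i)) (Π.sum-cong-≋ {h} λ i → begin
      (1# - x * q * q ^ toℕ i) * (1# - x * q * q ^ (h ℕ.+ h ∸ suc (toℕ i)))
        ≈⟨ solve 4 (λ x q u v → (:1 :- x :* q :* u) :* (:1 :- x :* q :* v) :=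
             x :* ((:1 :- q :* u) :* (:1 :- q :* v)) :+ (:1 :- x) :* (:1 :- x :* ((q :* u) :* (q :* v))))
             refl x q (q ^ toℕ i) (q ^ (h ℕ.+ h ∸ suc (toℕ i))) ⟩
      x * b (toℕ i) + (1# - x) * (1# - x * ((q ^ suc (toℕ i)) * (q ^ suc (h ℕ.+ h ∸ suc (toℕ i)))))
        ≈⟨ +-congˡ (*-congˡ (+-congˡ (-‿cong (*-congˡ
             (trans (sym (^-homo-* q (suc (toℕ i)) (suc (h ℕ.+ h ∸ suc (toℕ i)))))
                    (^-congʳ q (exponents (toℕ<n i)))))))) ⟩
      x * b (toℕ i) + D x ∎)

    product-1-q : product {h ℕ.+ h} (λ i → 1# - q * q ^ toℕ i) ≈ product {h} (λ i → b (toℕ i))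
    product-1-q = product-pair h (λ i → 1# - q * q ^ i)

  module QBinomial (q : Carrier) where

    -- C n k is the coefficient of xᵏ in ∏_{1≤i≤n} (1 - x qⁱ).
    C : ℕ → ℕ → Carrier
    C zero    zero    = 1#
    C zero    (suc k) = 0#
    C (suc n) zero    = C n zero
    C (suc n) (suc k) = C n (suc k) - q * q ^ n * C n k

    C-zero : ∀ n → C n 0 ≡ 1#
    C-zero zero    = ≡.refl
    C-zero (suc n) = C-zero n

    C-above : ∀ n k → n ℕ.< k → C n k ≈ 0#
    C-above zero    (suc k) _         = refl
    C-above (suc n) (suc k) (ℕ.s≤s n<k) = begin
      C n (suc k) - q * q ^ n * C n k
        ≈⟨ +-cong (C-above n (suc k) (ℕ.m≤n⇒m≤1+n n<k)) (-‿cong (*-congˡ (C-above n k n<k))) ⟩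
      0# - q * q ^ n * 0#
        ≈⟨ solve 1 (λ a → :0 :- a :* :0 := :0) refl _ ⟩
      0#
        ∎

    product-1-xq≈sum : ∀ x n → product {n} (λ i → 1# - x * q * q ^ toℕ i) ≈
                               sum {suc n} (λ k → C n (toℕ k) * x ^ toℕ k)
    product-1-xq≈sum x zero    = sym (trans (+-identityʳ _) (*-identityʳ 1#))
    product-1-xq≈sum x (suc n) = begin
      product {suc n} (λ i → 1# - x * q * q ^ toℕ i)
        ≈⟨ product-snoc n (λ i → 1# - x * q * q ^ i) ⟩
      product {n} (λ i → 1# - x * q * q ^ toℕ i) * (1# - x * q * q ^ n)
        ≈⟨ *-congʳ (product-1-xq≈sum x n) ⟩
      S * (1# - x * q * q ^ n)
        ≈⟨ solve 4 (λ S x q u → S :* (:1 :- x :* q :* u) := S :+ :- (q :* u :* x) :* S) refl S x q (q ^ n) ⟩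
      S + a * S
        -- The vanishing term of index `suc n` is appended. After the constant term is split off,
        -- the first sum then has as many terms as `a * S`, and the two combine termwise into the
        -- recursion of `C`.
        ≈⟨ +-congʳ (trans (sym (+-identityʳ S))
             (+-congˡ (sym (trans (*-congʳ (C-above n (suc n) ℕ.≤-refl)) (zeroˡ _))))) ⟩
      (S + C n (suc n) * x ^ suc n) + a * S
        ≈⟨ +-congʳ (sum-snoc (suc n) (λ k → C n k * x ^ k)) ⟨
      (C n 0 * 1# + sum {suc n} (λ k → C n (suc (toℕ k)) * x ^ suc (toℕ k))) + a * S
        ≈⟨ +-assoc _ _ _ ⟩
      C n 0 * 1# + (sum {suc n} (λ k → C n (suc (toℕ k)) * x ^ suc (toℕ k)) + a * S)
        ≈⟨ +-congˡ (+-congˡ (Σ.*-distribˡ-sum {suc n} a (λ k → C n (toℕ k) * x ^ toℕ k))) ⟩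
      C n 0 * 1# + (sum {suc n} (λ k → C n (suc (toℕ k)) * x ^ suc (toℕ k))
                      + sum {suc n} (λ k → a * (C n (toℕ k) * x ^ toℕ k)))
        ≈⟨ +-congˡ (Σ.∑-distrib-+ {suc n} (λ k → C n (suc (toℕ k)) * x ^ suc (toℕ k))
             (λ k → a * (C n (toℕ k) * x ^ toℕ k))) ⟨
      C n 0 * 1# + sum {suc n} (λ k → C n (suc (toℕ k)) * x ^ suc (toℕ k) + a * (C n (toℕ k) * x ^ toℕ k))
        ≈⟨ +-congˡ (Σ.sum-cong-≋ {suc n} λ k → solve 5 (λ c c′ x y a →
             c :* (x :* y) :+ :- (a :* x) :* (c′ :* y) := (c :- a :* c′) :* (x :* y))
             refl (C n (suc (toℕ k))) (C n (toℕ k)) x (x ^ toℕ k) (q * q ^ n)) ⟩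
      sum {suc (suc n)} (λ k → C (suc n) (toℕ k) * x ^ toℕ k)
        ∎
      where
      S = sum {suc n} (λ k → C n (toℕ k) * x ^ toℕ k)
      a = - (q * q ^ n * x)

    -- Stands in for the closed form C n k = (-1)ᵏ q^{k(k+1)/2} [n choose k]_q.
    C-ratio : ∀ n k → (1# - q * q ^ k) * C n (suc k) ≈ (q * q ^ n - q * q ^ k) * C n k
    C-ratio zero    zero    = solve 1 (λ q → (:1 :- q :* :1) :* :0 := (q :* :1 :- q :* :1) :* :1) refl q
    C-ratio zero    (suc k) = trans (zeroʳ _) (sym (zeroʳ _))
    C-ratio (suc n) zero    = begin
      (1# - q * 1#) * (A - q * N * B)
        ≈⟨ solve 4 (λ q N A B → (:1 :- q :* :1) :* (A :- q :* N :* B) :=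
             (:1 :- q :* :1) :* A :- (:1 :- q :* :1) :* (q :* N :* B)) refl q N A B ⟩
      (1# - q * 1#) * A - (1# - q * 1#) * (q * N * B)
        ≈⟨ +-congʳ (C-ratio n 0) ⟩
      (q * N - q * 1#) * B - (1# - q * 1#) * (q * N * B)
        ≈⟨ solve 3 (λ q N B → (q :* N :- q :* :1) :* B :- (:1 :- q :* :1) :* (q :* N :* B) :=
             (q :* (q :* N) :- q :* :1) :* B) refl q N B ⟩
      (q * (q * N) - q * 1#) * B
        ∎
      where
      N = q ^ n
      A = C n 1
      B = C n 0
    C-ratio (suc n) (suc k) = begin
      (1# - q * (q * K)) * (A - q * N * B)
        ≈⟨ solve 5 (λ q N K A B → (:1 :- q :* (q :* K)) :* (A :- q :* N :* B) :=
             (:1 :- q :* (q :* K)) :* A :- (:1 :- q :* (q :* K)) :* (q :* N :* B)) refl q N K A B ⟩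
      (1# - q * (q * K)) * A - (1# - q * (q * K)) * (q * N * B)
        ≈⟨ +-congʳ (C-ratio n (suc k)) ⟩
      (q * N - q * (q * K)) * B - (1# - q * (q * K)) * (q * N * B)
        -- Rearranged to isolate `(1# - q * K) * B`, the left side of the ratio at `k`, so that the
        -- second induction hypothesis applies.
        ≈⟨ solve 4 (λ q N K B →
             (q :* N :- q :* (q :* K)) :* B :- (:1 :- q :* (q :* K)) :* (q :* N :* B) :=
             q :* (q :* N :- q :* K) :* B :- q :* (q :* N) :* ((:1 :- q :* K) :* B)) refl q N K B ⟩
      q * (q * N - q * K) * B - q * (q * N) * ((1# - q * K) * B)
        ≈⟨ +-congˡ (-‿cong (*-congˡ (C-ratio n k))) ⟩
      q * (q * N - q * K) * B - q * (q * N) * ((q * N - q * K) * Z)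
        ≈⟨ solve 5 (λ q N K B Z →
             q :* (q :* N :- q :* K) :* B :- q :* (q :* N) :* ((q :* N :- q :* K) :* Z) :=
             (q :* (q :* N) :- q :* (q :* K)) :* (B :- q :* N :* Z)) refl q N K B Z ⟩
      (q * (q * N) - q * (q * K)) * (B - q * N * Z)
        ∎
      where
      N = q ^ n
      K = q ^ k
      A = C n (suc (suc k))
      B = C n (suc k)
      Z = C n k

-- Units and the q-binomial theorem at a root of unity

module Units {c ℓ} (R : CommutativeRing c ℓ) where

  open CommutativeRing R hiding (zero)
  open import Algebra.Definitions.RawSemiring (Semiring.rawSemiring semiring)
    using (_^_; sum; product) renaming (_×_ to _×#_)
  open import Algebra.Properties.Semiring.Exp semiring using (^-assocʳ; ^-congʳ)
  open import Algebra.Properties.Semiring.Divisibility semiring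
    using (_∣_; ∣ʳ-trans; ∣ʳ-respʳ-≈)
  open import Algebra.Properties.Semiring.Sum semiring using (*-distribˡ-sum; sum-cong-≋)
  open IntegerSolver R
  open Products R
  open FiniteSums +-commutativeMonoid using (sum-snoc)
  open import Algebra.Properties.Group +-group using (x∙y⁻¹≈ε⇒x≈y; ε⁻¹≈ε)
  open import Relation.Binary.Reasoning.Setoid setoid

  geometric : ∀ y n → sum {n} (λ i → y ^ toℕ i) * (1# - y) ≈ 1# - y ^ n
  geometric y zero    = solve 1 (λ y → :0 :* (:1 :- y) := :1 :- :1) refl y
  geometric y (suc n) = begin
    (1# + sum {n} (λ i → y * y ^ toℕ i)) * (1# - y)
      ≈⟨ *-congʳ (+-congˡ (*-distribˡ-sum {n} y (λ i → y ^ toℕ i))) ⟨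
    (1# + y * S) * (1# - y)
      ≈⟨ solve 2 (λ y S → (:1 :+ y :* S) :* (:1 :- y) := (:1 :- y) :+ y :* (S :* (:1 :- y))) refl y S ⟩
    (1# - y) + y * (S * (1# - y))
      ≈⟨ +-congˡ (*-congˡ (geometric y n)) ⟩
    (1# - y) + y * (1# - y ^ n)
      ≈⟨ solve 2 (λ y Y → (:1 :- y) :+ y :* (:1 :- Y) := :1 :- y :* Y) refl y (y ^ n) ⟩
    1# - y ^ suc n
      ∎
    where S = sum {n} (λ i → y ^ toℕ i)

  1-y∣1-y^n : ∀ y n → 1# - y ∣ 1# - y ^ n
  1-y∣1-y^n y n = sum {n} (λ i → y ^ toℕ i) , geometric y n

  1^n≈1 : ∀ {y} n → y ≈ 1# → y ^ n ≈ 1#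
  1^n≈1 zero    y≈1 = refl
  1^n≈1 (suc n) y≈1 = trans (*-cong y≈1 (1^n≈1 n y≈1)) (*-identityˡ 1#)

  -- Modulo `1# - y` every power of `y` is 1, so a sum of `n` of them is `n`.
  1-y∣n-sum : ∀ y n → 1# - y ∣ n ×# 1# - sum {n} (λ i → y ^ toℕ i)
  1-y∣n-sum y zero    = 0# , solve 1 (λ y → :0 :* (:1 :- y) := :0 :- :0) refl y
  1-y∣n-sum y (suc n) with r , eq ← 1-y∣n-sum y n = r + S , (begin
    (r + S) * (1# - y)
      ≈⟨ distribʳ _ r S ⟩
    r * (1# - y) + S * (1# - y)
      ≈⟨ +-cong eq (geometric y n) ⟩
    (n ×# 1# - S) + (1# - y ^ n)
      ≈⟨ solve 3 (λ N S Y → (N :- S) :+ (:1 :- Y) := (:1 :+ N) :- (S :+ Y)) refl (n ×# 1#) S (y ^ n) ⟩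
    suc n ×# 1# - (S + y ^ n)
      ≈⟨ +-congˡ (-‿cong (sum-snoc n (y ^_))) ⟨
    suc n ×# 1# - sum {suc n} (λ i → y ^ toℕ i)
      ∎)
    where S = sum {n} (λ i → y ^ toℕ i)

  module Cyclotomic {q p} (p-prime : Prime p) (Φ≈0 : sum {p} (λ i → q ^ toℕ i) ≈ 0#)
    (p-unit : p ×# 1# ∣ 1#) where

    q^p≈1 : q ^ p ≈ 1#
    q^p≈1 = sym (x∙y⁻¹≈ε⇒x≈y 1# (q ^ p)
      (trans (sym (geometric q p)) (trans (*-congʳ Φ≈0) (zeroˡ _))))

    -- Modulo `1# - q` the sum of the `p` powers of `q` is `p`. That sum is zero in the ring, so
    -- `1# - q` divides the unit `p`.
    1-q∣1 : 1# - q ∣ 1#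
    1-q∣1 = ∣ʳ-trans (∣ʳ-respʳ-≈ (trans (+-congˡ (trans (-‿cong Φ≈0) ε⁻¹≈ε)) (+-identityʳ _))
      (1-y∣n-sum q p)) p-unit

    -- By Bézout for the coprime numbers `p` and `k`, together with `q ^ p ≈ 1#`, some power
    -- `(q ^ k) ^ y` is either `q` or its inverse, and `1# - q ^ k` divides 1 minus that power.
    1-q^k∣1-q : ∀ {k} → .{{ℕ.NonZero k}} → k ℕ.< p → 1# - q ^ k ∣ 1# - q
    1-q^k∣1-q {k} k<p with coprime-Bézout (prime⇒coprime p-prime k<p)
    ... | Bézout.-+ x y eq = ∣ʳ-respʳ-≈ (+-congˡ (-‿cong (begin
      (q ^ k) ^ y        ≈⟨ ^-assocʳ q k y ⟩
      q ^ (k ℕ.* y)      ≈⟨ ^-congʳ q (≡.trans (ℕ.*-comm k y) (≡.trans (≡.sym eq) (≡.cong suc (ℕ.*-comm x p)))) ⟩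
      q * q ^ (p ℕ.* x)  ≈⟨ *-congˡ (trans (sym (^-assocʳ q p x)) (1^n≈1 x q^p≈1)) ⟩
      q * 1#             ≈⟨ *-identityʳ q ⟩
      q                  ∎))) (1-y∣1-y^n (q ^ k) y)
    -- Here `k * y + 1` is a multiple of `p`, so `(q ^ k) ^ y` is the inverse of `q`; the factor
    -- `- q` turns `1 - 1/q` into `1 - q`.
    ... | Bézout.+- x y eq = ∣ʳ-trans (1-y∣1-y^n (q ^ k) y) (- q , (begin
      - q * (1# - (q ^ k) ^ y)   ≈⟨ solve 2 (λ q Y → :- q :* (:1 :- Y) := q :* Y :- q) refl q ((q ^ k) ^ y) ⟩
      q * (q ^ k) ^ y - q        ≈⟨ +-congʳ (begin
        q * (q ^ k) ^ y     ≈⟨ *-congˡ (^-assocʳ q k y) ⟩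
        q ^ suc (k ℕ.* y)   ≈⟨ ^-congʳ q (≡.trans (≡.cong suc (ℕ.*-comm k y)) (≡.trans eq (ℕ.*-comm x p))) ⟩
        q ^ (p ℕ.* x)       ≈⟨ ^-assocʳ q p x ⟨
        (q ^ p) ^ x         ≈⟨ 1^n≈1 x q^p≈1 ⟩
        1#                  ∎) ⟩
      1# - q                     ∎))

    1-q^k∣1 : ∀ {k} → .{{ℕ.NonZero k}} → k ℕ.< p → 1# - q ^ k ∣ 1#
    1-q^k∣1 k<p = ∣ʳ-trans (1-q^k∣1-q k<p) 1-q∣1

  module RootOfUnity (q : Carrier) (n : ℕ) (q^p≈1 : q ^ suc n ≈ 1#)
    (unit : ∀ {k} → k ℕ.< n → 1# - q ^ suc k ∣ 1#) where

    open QBinomial q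

    -- Since `q ^ suc n` is 1, the two factors in `C-ratio` both become `1# - q ^ suc k`. Cancelling
    -- this unit shows that consecutive coefficients agree, and the first is 1.
    C≈1 : ∀ k → k ℕ.≤ n → C n k ≈ 1#
    C≈1 zero    _   = reflexive (C-zero n)
    C≈1 (suc k) k<n with u , u*[1-q^k]≈1 ← unit k<n = begin
      C n (suc k)                              ≈⟨ *-identityˡ _ ⟨
      1# * C n (suc k)                         ≈⟨ *-congʳ u*[1-q^k]≈1 ⟨
      u * (1# - q ^ suc k) * C n (suc k)       ≈⟨ *-assoc _ _ _ ⟩
      u * ((1# - q ^ suc k) * C n (suc k))     ≈⟨ *-congˡ (C-ratio n k) ⟩
      u * ((q ^ suc n - q ^ suc k) * C n k)    ≈⟨ *-congˡ (*-cong (+-congʳ q^p≈1) (C≈1 k (ℕ.<⇒≤ k<n))) ⟩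
      u * ((1# - q ^ suc k) * 1#)              ≈⟨ *-congˡ (*-identityʳ _) ⟩
      u * (1# - q ^ suc k)                     ≈⟨ u*[1-q^k]≈1 ⟩
      1#                                       ∎

    product≈sum : ∀ x → product {n} (λ i → 1# - x * q * q ^ toℕ i) ≈ sum {suc n} (λ k → x ^ toℕ k)
    product≈sum x = trans (product-1-xq≈sum x n)
      (sum-cong-≋ {suc n} {λ k → C n (toℕ k) * x ^ toℕ k} λ k →
        trans (*-congʳ (C≈1 (toℕ k) (ℕ.≤-pred (toℕ<n k)))) (*-identityˡ _))

-- The quotient ring modulo `P`

module Quotient {c ℓ} (A : CommutativeRing c ℓ) (P : CommutativeRing.Carrier A) where

  open CommutativeRing A hiding (zero)
  open import Algebra.Properties.Semiring.Divisibility semiring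
    using (_∣_; ∣ʳ-respʳ-≈)
  open IntegerSolver A

  infix 4 _≡P_
  -- A record rather than a synonym for the divisibility, so that `f` and `g` can be recovered from
  -- the type in equational reasoning.
  record _≡P_ (f g : Carrier) : Set (c ⊔ ℓ) where
    constructor mod
    field difference : P ∣ f - g
  open _≡P_ public

  ≈⇒≡P : ∀ {f g} → f ≈ g → f ≡P g
  ≈⇒≡P {f} {g} f≈g = mod (0# , trans (zeroˡ P) (sym (trans (+-congʳ f≈g) (-‿inverseʳ g))))

  quotient : CommutativeRing c (c ⊔ ℓ)
  quotient = record
    { Carrier = Carrier
    ; _≈_ = _≡P_
    ; _+_ = _+_
    ; _*_ = _*_
    ; -_  = -_
    ; 0#  = 0#
    ; 1#  = 1#
    ; isCommutativeRing = record
      { isRing = record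
        { +-isAbelianGroup = record
          { isGroup = record
            { isMonoid = record
              { isSemigroup = record
                { isMagma = record
                  { isEquivalence = record
                    { refl = ≈⇒≡P refl
                    ; sym = λ { {f} {g} (mod (r , e)) → mod (- r , trans
                        (solve 2 (λ r P → :- r :* P := :- (r :* P)) refl r P)
                        (trans (-‿cong e) (solve 2 (λ f g → :- (f :- g) := g :- f) refl f g))) }
                    ; trans = λ { {f} {g} {h} (mod (r , e)) (mod (s , e′)) → mod (r + s , trans (distribʳ P r s)
                        (trans (+-cong e e′) (solve 3 (λ f g h → (f :- g) :+ (g :- h) := f :- h) refl f g h))) }
                    }
                  ; ∙-cong = λ { {f} {f′} {g} {g′} (mod (r , e)) (mod (s , e′)) → mod (r + s , trans (distribʳ P r s)
                      (trans (+-cong e e′) (solve 4 (λ f f′ g g′ →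
                        (f :- f′) :+ (g :- g′) := (f :+ g) :- (f′ :+ g′)) refl f f′ g g′))) }
                  }
                ; assoc = λ f g h → ≈⇒≡P (+-assoc f g h)
                }
              ; identity = (λ f → ≈⇒≡P (+-identityˡ f)) , λ f → ≈⇒≡P (+-identityʳ f)
              }
            ; inverse = (λ f → ≈⇒≡P (-‿inverseˡ f)) , λ f → ≈⇒≡P (-‿inverseʳ f)
            ; ⁻¹-cong = λ { {f} {g} (mod (r , e)) → mod (- r , trans
                (solve 2 (λ r P → :- r :* P := :- (r :* P)) refl r P)
                (trans (-‿cong e) (solve 2 (λ f g → :- (f :- g) := :- f :- :- g) refl f g))) }
            }
          ; comm = λ f g → ≈⇒≡P (+-comm f g)
          }
        ; *-cong = λ { {f} {f′} {g} {g′} (mod (r , e)) (mod (s , e′)) → mod (r * g + f′ * s , trans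
            (solve 5 (λ r s P g f → (r :* g :+ f :* s) :* P := (r :* P) :* g :+ f :* (s :* P)) refl r s P g f′)
            (trans (+-cong (*-congʳ e) (*-congˡ e′))
              (solve 4 (λ f f′ g g′ → (f :- f′) :* g :+ f′ :* (g :- g′) := f :* g :- f′ :* g′) refl f f′ g g′))) }
        ; *-assoc = λ f g h → ≈⇒≡P (*-assoc f g h)
        ; *-identity = (λ f → ≈⇒≡P (*-identityˡ f)) , λ f → ≈⇒≡P (*-identityʳ f)
        ; distrib = (λ f g h → ≈⇒≡P (distribˡ f g h)) , λ f g h → ≈⇒≡P (distribʳ f g h)
        }
      ; *-comm = λ f g → ≈⇒≡P (*-comm f g)
      }
    }

-- R[t]/(t³)
module Jets {c ℓ} (R : CommutativeRing c ℓ) where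

  open CommutativeRing R hiding (zero)
  open IntegerSolver R

  infix 4 _≈J_
  record Jet : Set c where
    constructor jet
    field c₀ c₁ c₂ : Carrier
  open Jet public

  record _≈J_ (a b : Jet) : Set ℓ where
    constructor mk≈J
    field
      ≈₀ : c₀ a ≈ c₀ b
      ≈₁ : c₁ a ≈ c₁ b
      ≈₂ : c₂ a ≈ c₂ b
  open _≈J_ public

  _+J_ _*J_ : Jet → Jet → Jet
  jet a₀ a₁ a₂ +J jet b₀ b₁ b₂ = jet (a₀ + b₀) (a₁ + b₁) (a₂ + b₂)
  jet a₀ a₁ a₂ *J jet b₀ b₁ b₂ = jet (a₀ * b₀) (a₀ * b₁ + a₁ * b₀) (a₀ * b₂ + a₁ * b₁ + a₂ * b₀)

  ι : Carrier → Jet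
  ι a = jet a 0# 0#

  *J-comm : ∀ a b → a *J b ≈J b *J a
  *J-comm (jet a₀ a₁ a₂) (jet b₀ b₁ b₂) = mk≈J
    (*-comm a₀ b₀)
    (solve 4 (λ a₀ a₁ b₀ b₁ → a₀ :* b₁ :+ a₁ :* b₀ := b₀ :* a₁ :+ b₁ :* a₀) refl a₀ a₁ b₀ b₁)
    (solve 6 (λ a₀ a₁ a₂ b₀ b₁ b₂ → a₀ :* b₂ :+ a₁ :* b₁ :+ a₂ :* b₀ := b₀ :* a₂ :+ b₁ :* a₁ :+ b₂ :* a₀)
      refl a₀ a₁ a₂ b₀ b₁ b₂)

  *J-identityˡ : ∀ a → ι 1# *J a ≈J a
  *J-identityˡ (jet a₀ a₁ a₂) = mk≈J
    (*-identityˡ a₀)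
    (solve 2 (λ a₀ a₁ → :1 :* a₁ :+ :0 :* a₀ := a₁) refl a₀ a₁)
    (solve 3 (λ a₀ a₁ a₂ → :1 :* a₂ :+ :0 :* a₁ :+ :0 :* a₀ := a₂) refl a₀ a₁ a₂)

  *J-distribˡ : ∀ a b d → a *J (b +J d) ≈J (a *J b) +J (a *J d)
  *J-distribˡ (jet a₀ a₁ a₂) (jet b₀ b₁ b₂) (jet d₀ d₁ d₂) = mk≈J
    (distribˡ a₀ b₀ d₀)
    (solve 6 (λ a₀ a₁ b₀ b₁ d₀ d₁ → a₀ :* (b₁ :+ d₁) :+ a₁ :* (b₀ :+ d₀) :=
      (a₀ :* b₁ :+ a₁ :* b₀) :+ (a₀ :* d₁ :+ a₁ :* d₀)) refl a₀ a₁ b₀ b₁ d₀ d₁)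
    (solve 9 (λ a₀ a₁ a₂ b₀ b₁ b₂ d₀ d₁ d₂ →
      a₀ :* (b₂ :+ d₂) :+ a₁ :* (b₁ :+ d₁) :+ a₂ :* (b₀ :+ d₀) :=
      (a₀ :* b₂ :+ a₁ :* b₁ :+ a₂ :* b₀) :+ (a₀ :* d₂ :+ a₁ :* d₁ :+ a₂ :* d₀))
      refl a₀ a₁ a₂ b₀ b₁ b₂ d₀ d₁ d₂)

  *J-cong : ∀ {a a′ b b′} → a ≈J a′ → b ≈J b′ → a *J b ≈J a′ *J b′
  *J-cong (mk≈J e₀ e₁ e₂) (mk≈J e₀′ e₁′ e₂′) = mk≈J
    (*-cong e₀ e₀′)
    (+-cong (*-cong e₀ e₁′) (*-cong e₁ e₀′))
    (+-cong (+-cong (*-cong e₀ e₂′) (*-cong e₁ e₁′)) (*-cong e₂ e₀′))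

  *J-assoc : ∀ a b d → (a *J b) *J d ≈J a *J (b *J d)
  *J-assoc (jet a₀ a₁ a₂) (jet b₀ b₁ b₂) (jet d₀ d₁ d₂) = mk≈J
    (*-assoc a₀ b₀ d₀)
    (solve 6 (λ a₀ a₁ b₀ b₁ d₀ d₁ →
      (a₀ :* b₀) :* d₁ :+ (a₀ :* b₁ :+ a₁ :* b₀) :* d₀ :=
      a₀ :* (b₀ :* d₁ :+ b₁ :* d₀) :+ a₁ :* (b₀ :* d₀)) refl a₀ a₁ b₀ b₁ d₀ d₁)
    (solve 9 (λ a₀ a₁ a₂ b₀ b₁ b₂ d₀ d₁ d₂ →
      (a₀ :* b₀) :* d₂ :+ (a₀ :* b₁ :+ a₁ :* b₀) :* d₁ :+ (a₀ :* b₂ :+ a₁ :* b₁ :+ a₂ :* b₀) :* d₀ :=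
      a₀ :* (b₀ :* d₂ :+ b₁ :* d₁ :+ b₂ :* d₀) :+ a₁ :* (b₀ :* d₁ :+ b₁ :* d₀) :+ a₂ :* (b₀ :* d₀))
      refl a₀ a₁ a₂ b₀ b₁ b₂ d₀ d₁ d₂)

  ≈J-trans : ∀ {a b d} → a ≈J b → b ≈J d → a ≈J d
  ≈J-trans (mk≈J e₀ e₁ e₂) (mk≈J e₀′ e₁′ e₂′) = mk≈J (trans e₀ e₀′) (trans e₁ e₁′) (trans e₂ e₂′)

  jets : CommutativeRing c ℓ
  jets = record
    { Carrier = Jet
    ; _≈_ = _≈J_
    ; _+_ = _+J_
    ; _*_ = _*J_
    ; -_  = λ a → jet (- c₀ a) (- c₁ a) (- c₂ a)
    ; 0#  = ι 0#
    ; 1#  = ι 1#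
    ; isCommutativeRing = record
      { isRing = record
        { +-isAbelianGroup = record
          { isGroup = record
            { isMonoid = record
              { isSemigroup = record
                { isMagma = record
                  { isEquivalence = record
                    { refl  = mk≈J refl refl refl
                    ; sym   = λ (mk≈J e₀ e₁ e₂) → mk≈J (sym e₀) (sym e₁) (sym e₂)
                    ; trans = ≈J-trans
                    }
                  ; ∙-cong = λ (mk≈J e₀ e₁ e₂) (mk≈J e₀′ e₁′ e₂′) →
                      mk≈J (+-cong e₀ e₀′) (+-cong e₁ e₁′) (+-cong e₂ e₂′)
                  }
                ; assoc = λ a b d → mk≈J (+-assoc _ _ _) (+-assoc _ _ _) (+-assoc _ _ _)
                }
              ; identity = (λ a → mk≈J (+-identityˡ _) (+-identityˡ _) (+-identityˡ _))
                         , (λ a → mk≈J (+-identityʳ _) (+-identityʳ _) (+-identityʳ _))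
              }
            ; inverse = (λ a → mk≈J (-‿inverseˡ _) (-‿inverseˡ _) (-‿inverseˡ _))
                      , (λ a → mk≈J (-‿inverseʳ _) (-‿inverseʳ _) (-‿inverseʳ _))
            ; ⁻¹-cong = λ (mk≈J e₀ e₁ e₂) → mk≈J (-‿cong e₀) (-‿cong e₁) (-‿cong e₂)
            }
          ; comm = λ a b → mk≈J (+-comm _ _) (+-comm _ _) (+-comm _ _)
          }
        ; *-cong = *J-cong
        ; *-assoc = *J-assoc
        ; *-identity = *J-identityˡ , λ a → ≈J-trans (*J-comm a (ι 1#)) (*J-identityˡ a)
        ; distrib = *J-distribˡ , λ a b d → ≈J-trans (*J-comm (b +J d) a)
            (≈J-trans (*J-distribˡ a b d) (mk≈J
              (+-cong (≈₀ (*J-comm a b)) (≈₀ (*J-comm a d)))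
              (+-cong (≈₁ (*J-comm a b)) (≈₁ (*J-comm a d)))
              (+-cong (≈₂ (*J-comm a b)) (≈₂ (*J-comm a d)))))
        }
      ; *-comm = *J-comm
      }
    }

-- Transport along ring homomorphisms

module Homomorphisms {c ℓ c′ ℓ′} (S : CommutativeRing c ℓ) (T : CommutativeRing c′ ℓ′)
  {f : CommutativeRing.Carrier S → CommutativeRing.Carrier T}
  (f-homo : IsRingHomomorphism (CommutativeRing.rawRing S) (CommutativeRing.rawRing T) f) where

  private
    module S = CommutativeRing S
    module T = CommutativeRing T
    module S′ = RawSemiringDefinitions (Semiring.rawSemiring S.semiring)
    module T′ = RawSemiringDefinitions (Semiring.rawSemiring T.semiring)
    module SP = Products S
    module TP = Products T

  open IsRingHomomorphism f-homo

  ^-homo : ∀ x n → f (x S′.^ n) T.≈ f x T′.^ n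
  ^-homo x zero    = 1#-homo
  ^-homo x (suc n) = T.trans (*-homo x _) (T.*-congˡ (^-homo x n))

  ×1-homo : ∀ n → f (n S′.× S.1#) T.≈ n T′.× T.1#
  ×1-homo zero    = 0#-homo
  ×1-homo (suc n) = T.trans (+-homo S.1# _) (T.+-cong 1#-homo (×1-homo n))

  sum-homo : ∀ n {g : ℕ → S.Carrier} {g′ : ℕ → T.Carrier} → (∀ i → f (g i) T.≈ g′ i) →
             f (S′.sum {n} (λ i → g (toℕ i))) T.≈ T′.sum {n} (λ i → g′ (toℕ i))
  sum-homo zero    g≈g′ = 0#-homo
  sum-homo (suc n) g≈g′ = T.trans (+-homo _ _) (T.+-cong (g≈g′ 0) (sum-homo n (λ i → g≈g′ (suc i))))

  product-homo : ∀ n {g : ℕ → S.Carrier} {g′ : ℕ → T.Carrier} → (∀ i → f (g i) T.≈ g′ i) →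
                 f (S′.product {n} (λ i → g (toℕ i))) T.≈ T′.product {n} (λ i → g′ (toℕ i))
  product-homo zero    g≈g′ = 1#-homo
  product-homo (suc n) g≈g′ = T.trans (*-homo _ _) (T.*-cong (g≈g′ 0) (product-homo n (λ i → g≈g′ (suc i))))

  e-homo : ∀ h {b : ℕ → S.Carrier} {b′ : ℕ → T.Carrier} → (∀ i → f (b i) T.≈ b′ i) →
           f (SP.e h b) T.≈ TP.e h b′
  e-homo zero    b≈b′ = 0#-homo
  e-homo (suc h) b≈b′ = T.trans (+-homo _ _)
    (T.+-cong (product-homo h (λ i → b≈b′ (suc i)))
      (T.trans (*-homo _ _) (T.*-cong (b≈b′ 0) (e-homo h (λ i → b≈b′ (suc i))))))

  1-q^k-homo : ∀ q k → f (S.1# S.- q S′.^ k) T.≈ T.1# T.- f q T′.^ k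
  1-q^k-homo q k = T.trans (+-homo _ _) (T.+-cong 1#-homo (T.trans (-‿homo _) (T.-‿cong (^-homo q k))))

  b-homo : ∀ q h i → f (SP.Pairing.b q h i) T.≈ TP.Pairing.b (f q) h i
  b-homo q h i = T.trans (*-homo _ _) (T.*-cong (1-q^k-homo q (suc i))
    (1-q^k-homo q (suc (h ℕ.+ h ∸ suc i))))

module JetHomomorphisms {c ℓ} (R : CommutativeRing c ℓ) where

  open CommutativeRing R hiding (zero)
  open IntegerSolver R
  open Jets R
  open import Algebra.Properties.Group +-group using (ε⁻¹≈ε)

  -- Setting `t = 0`; this brings `e` of constant jets back to `R`.
  c₀-homo : IsRingHomomorphism (CommutativeRing.rawRing jets) rawRing c₀
  c₀-homo = record
    { isSemiringHomomorphism = record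
      { isNearSemiringHomomorphism = record
        { +-isMonoidHomomorphism = record
          { isMagmaHomomorphism = record
            { isRelHomomorphism = record { cong = ≈₀ }
            ; homo = λ _ _ → refl
            }
          ; ε-homo = refl
          }
        ; *-homo = λ _ _ → refl
        }
      ; 1#-homo = refl
      }
    ; -‿homo = λ _ → refl
    }

  -- Constants as jets. The root of unity and the inverses known in `R` carry over, so that the
  -- product formula can be evaluated at `1+t`.
  ι-homo : IsRingHomomorphism rawRing (CommutativeRing.rawRing jets) ι
  ι-homo = record
    { isSemiringHomomorphism = record
      { isNearSemiringHomomorphism = record
        { +-isMonoidHomomorphism = record
          { isMagmaHomomorphism = record
            { isRelHomomorphism = record { cong = λ a≈b → mk≈J a≈b refl refl }
            ; homo = λ a b → mk≈J refl (sym (+-identityˡ 0#)) (sym (+-identityˡ 0#))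
            }
          ; ε-homo = mk≈J refl refl refl
          }
        ; *-homo = λ a b → mk≈J refl
            (solve 2 (λ a b → :0 := a :* :0 :+ :0 :* b) refl a b)
            (solve 2 (λ a b → :0 := a :* :0 :+ :0 :* :0 :+ :0 :* b) refl a b)
        }
      ; 1#-homo = mk≈J refl refl refl
      }
    ; -‿homo = λ a → mk≈J refl (sym ε⁻¹≈ε) (sym ε⁻¹≈ε)
    }

-- Evaluation of `e` by second-order expansion at 1

module SymmetricFunction {c ℓ} (R : CommutativeRing c ℓ) where

  open CommutativeRing R hiding (zero)
  open import Algebra.Definitions.RawSemiring (Semiring.rawSemiring semiring)
    using (_^_; _∣_; _×′_) renaming (_×_ to _×#_)
  open import Algebra.Properties.Monoid.Mult +-monoid using (×-homo-+)
  open IntegerSolver R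
  open Products R using (e; module Pairing)
  open Jets R
  open JetHomomorphisms R
  private module JR = CommutativeRing jets
  module J where
    open CommutativeRing jets public
    open RawSemiringDefinitions (Semiring.rawSemiring JR.semiring) public
      using (_^_; sum; product; _∣_) renaming (_×_ to _×#_)
    open FiniteSums JR.+-commutativeMonoid public using (sum-snoc)
    open Products jets public
    open Units jets public
    module Sum = CommutativeMonoidSum JR.+-commutativeMonoid
    module Prod = CommutativeMonoidSum JR.*-commutativeMonoid
  module ι = Homomorphisms R jets ι-homo
  module c₀ = Homomorphisms jets R c₀-homo

  1+t : Jet
  1+t = jet 1# 1# 0#

  c₀-[1+t]^ : ∀ k → c₀ (1+t J.^ k) ≈ 1#
  c₀-[1+t]^ zero    = refl
  c₀-[1+t]^ (suc k) = trans (*-identityˡ _) (c₀-[1+t]^ k)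

  c₁-[1+t]^ : ∀ k → c₁ (1+t J.^ k) ≈ k ×# 1#
  c₁-[1+t]^ zero    = refl
  c₁-[1+t]^ (suc k) = trans (+-cong (*-identityˡ _) (*-identityˡ _))
    (trans (+-comm _ _) (+-cong (c₀-[1+t]^ k) (c₁-[1+t]^ k)))

  -- The coefficient is the binomial `k` choose 2, with its denominator cleared.
  2c₂-[1+t]^ : ∀ k → 2 ×′ 1# * c₂ (1+t J.^ k) ≈ k ×# 1# * (k ×# 1# - 1#)
  2c₂-[1+t]^ zero    = solve 0 (con (+ 2) :* :0 := :0 :* (:0 :- :1)) refl
  2c₂-[1+t]^ (suc k) = begin
    2 ×′ 1# * (1# * Z₂ + 1# * Z₁ + 0# * Z₀)
      ≈⟨ solve 3 (λ Z₀ Z₁ Z₂ → con (+ 2) :* (:1 :* Z₂ :+ :1 :* Z₁ :+ :0 :* Z₀) :=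
           con (+ 2) :* Z₂ :+ con (+ 2) :* Z₁) refl Z₀ Z₁ Z₂ ⟩
    2 ×′ 1# * Z₂ + 2 ×′ 1# * Z₁
      ≈⟨ +-cong (2c₂-[1+t]^ k) (*-congˡ (c₁-[1+t]^ k)) ⟩
    K * (K - 1#) + 2 ×′ 1# * K
      ≈⟨ solve 1 (λ K → K :* (K :- :1) :+ con (+ 2) :* K := (:1 :+ K) :* ((:1 :+ K) :- :1)) refl K ⟩
    suc k ×# 1# * (suc k ×# 1# - 1#)
      ∎
    where
    open SetoidReasoning setoid
    K = k ×# 1#
    Z₀ = c₀ (1+t J.^ k)
    Z₁ = c₁ (1+t J.^ k)
    Z₂ = c₂ (1+t J.^ k)

  -- The hockey-stick identity: the binomials `i` choose 2 with `i < k` add up to `k` choose 3, with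
  -- its denominator cleared.
  6c₂-sum-[1+t]^ : ∀ k → 6 ×′ 1# * c₂ (J.sum {k} (λ i → 1+t J.^ toℕ i)) ≈
                   k ×# 1# * (k ×# 1# - 1#) * (k ×# 1# - 2 ×′ 1#)
  6c₂-sum-[1+t]^ zero    = solve 0 (con (+ 6) :* :0 :=
    :0 :* (:0 :- :1) :* (:0 :- con (+ 2))) refl
  6c₂-sum-[1+t]^ (suc k) = begin
    6 ×′ 1# * c₂ (J.sum {suc k} (λ i → 1+t J.^ toℕ i))
      ≈⟨ *-congˡ (≈₂ (J.sum-snoc k (1+t J.^_))) ⟩
    6 ×′ 1# * (Σ₂ + Z₂)
      ≈⟨ solve 2 (λ Σ₂ Z₂ → con (+ 6) :* (Σ₂ :+ Z₂) :=
           con (+ 6) :* Σ₂ :+ con (+ 3) :* (con (+ 2) :* Z₂)) refl Σ₂ Z₂ ⟩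
    6 ×′ 1# * Σ₂ + 3 ×′ 1# * (2 ×′ 1# * Z₂)
      ≈⟨ +-cong (6c₂-sum-[1+t]^ k) (*-congˡ (2c₂-[1+t]^ k)) ⟩
    K * (K - 1#) * (K - 2 ×′ 1#) + 3 ×′ 1# * (K * (K - 1#))
      ≈⟨ solve 1 (λ K → K :* (K :- :1) :* (K :- con (+ 2)) :+ con (+ 3) :* (K :* (K :- :1)) :=
           (:1 :+ K) :* ((:1 :+ K) :- :1) :* ((:1 :+ K) :- con (+ 2))) refl K ⟩
    suc k ×# 1# * (suc k ×# 1# - 1#) * (suc k ×# 1# - 2 ×′ 1#)
      ∎
    where
    open SetoidReasoning setoid
    K = k ×# 1#
    Σ₂ = c₂ (J.sum {k} (λ i → 1+t J.^ toℕ i))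
    Z₂ = c₂ (1+t J.^ k)

  module _ (q : Carrier) (h : ℕ) (q^p≈1 : q ^ suc (h ℕ.+ h) ≈ 1#)
    (unit : ∀ {k} → k ℕ.< h ℕ.+ h → 1# - q ^ suc k ∣ 1#) where

    n : ℕ
    n = h ℕ.+ h

    qJ^p≈1 : ι q J.^ suc n J.≈ J.1#
    qJ^p≈1 = J.trans (J.sym (ι.^-homo q (suc n))) (mk≈J q^p≈1 refl refl)

    unitJ : ∀ {k} → k ℕ.< n → (J.1# J.- ι q J.^ suc k) J.∣ J.1#
    unitJ {k} k<n with u , u*[1-q^k]≈1 ← unit k<n = ι u ,
      J.trans (J.*-congˡ {ι u} (J.sym (ι.1-q^k-homo q (suc k))))
        (J.trans (J.sym (IsRingHomomorphism.*-homo ι-homo u (1# - q ^ suc k)))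
          (mk≈J u*[1-q^k]≈1 refl refl))

    open J.RootOfUnity (ι q) n qJ^p≈1 unitJ using (product≈sum)
    module PJ = J.Pairing (ι q) h

    -- The product formula at `x = 1`, where the geometric sum is `p`. It is proved over jets
    -- because that is where `product-expand` is applied.
    product-b≈p : J.product {h} (λ i → PJ.b (toℕ i)) J.≈ ι (suc n ×# 1#)
    product-b≈p = begin
      J.product {h} (λ i → PJ.b (toℕ i))
        ≈⟨ PJ.product-1-q ⟨
      J.product {n} (λ i → J.1# J.- ι q J.* ι q J.^ toℕ i)
        ≈⟨ J.Prod.sum-cong-≋ {n} {λ i → J.1# J.- ι q J.* ι q J.^ toℕ i} (λ i →
             J.+-congˡ {J.1#} (J.-‿cong (J.*-congʳ {ι q J.^ toℕ i}
               (J.sym (J.*-identityˡ (ι q)))))) ⟩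
      J.product {n} (λ i → J.1# J.- J.1# J.* ι q J.* ι q J.^ toℕ i)
        ≈⟨ product≈sum J.1# ⟩
      J.sum {suc n} (λ i → J.1# J.^ toℕ i)
        ≈⟨ J.Sum.sum-cong-≋ {suc n} {λ i → J.1# J.^ toℕ i}
             (λ i → J.1^n≈1 (toℕ i) (J.refl {J.1#})) ⟩
      J.sum {suc n} (λ i → J.1#)
        ≈⟨ J.Sum.sum-replicate (suc n) ⟩
      suc n J.×# J.1#
        ≈⟨ ι.×1-homo (suc n) ⟨
      ι (suc n ×# 1#)
        ∎
      where open SetoidReasoning J.setoid

    -- With `q ^ p` equal to 1, `D x` becomes the square of `1 - x`, and `1 - x` is `-t` at this
    -- point.
    D≈t² : PJ.D 1+t J.≈ jet 0# 0# 1#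
    D≈t² = J.trans (J.*-congˡ {J.1# J.- 1+t} (J.+-congˡ {J.1#} (J.-‿cong
        (J.trans (J.*-congˡ {1+t} qJ^p≈1) (J.*-identityʳ 1+t)))))
      (mk≈J
        (solve 0 ((:1 :- :1) :* (:1 :- :1) := :0) refl)
        (solve 0 ((:1 :- :1) :* (:0 :- :1) :+ (:0 :- :1) :* (:1 :- :1) := :0) refl)
        (solve 0 ((:1 :- :1) :* (:0 :- :0) :+ (:0 :- :1) :* (:0 :- :1) :+ (:0 :- :0) :* (:1 :- :1)
          := :1) refl))

    -- Two evaluations of the same product at `1+t` are compared in the coefficient of `t^2`: the
    -- geometric sum, and the expansion by pairs.
    c₂-sum : c₂ (J.sum {suc n} (λ i → 1+t J.^ toℕ i)) ≈
             c₂ (1+t J.^ h) * suc n ×# 1# + e h (Pairing.b q h)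
    c₂-sum with r , eq ← J.product-expand h PJ.b 1+t (PJ.D 1+t) = begin
      c₂ (J.sum {suc n} (λ i → 1+t J.^ toℕ i))
        ≈⟨ ≈₂ (J.trans (J.sym (product≈sum 1+t)) (J.trans (PJ.product-1-xq 1+t) (J.trans eq
             (J.+-cong (J.*-congˡ {1+t J.^ h} product-b≈p) (J.*-cong D≈t²
               (J.+-congˡ {1+t J.^ (h ∸ 1) J.* J.e h PJ.b} (J.*-congʳ {r} D≈t²))))))) ⟩
      (Z₀ * 0# + Z₁ * 0# + Z₂ * N)
        + (0# * _ + 0# * _ + 1# * (c₀ (1+t J.^ (h ∸ 1)) * c₀ (J.e h PJ.b) + 0# * c₀ r))
        -- A factor `t^2` selects the constant coefficient of its cofactor. The unknown `r` carries
        -- a second such factor and drops out.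
        ≈⟨ solve 9 (λ Z₀ Z₁ Z₂ N x y u v r →
             (Z₀ :* :0 :+ Z₁ :* :0 :+ Z₂ :* N) :+ (:0 :* x :+ :0 :* y :+ :1 :* (u :* v :+ :0 :* r)) :=
             Z₂ :* N :+ u :* v) refl Z₀ Z₁ Z₂ N _ _ _ _ _ ⟩
      Z₂ * N + c₀ (1+t J.^ (h ∸ 1)) * c₀ (J.e h PJ.b)
        -- The power of `1+t` has constant coefficient 1, and `c₀` maps the `e` formed over jets to
        -- the one formed over `R`.
        ≈⟨ +-congˡ (trans (*-cong (c₀-[1+t]^ (h ∸ 1)) (c₀.e-homo h (c₀.b-homo (ι q) h))) (*-identityˡ _)) ⟩
      Z₂ * N + e h (Pairing.b q h)
        ∎
      where
      open SetoidReasoning setoid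
      N = suc n ×# 1#
      Z₀ = c₀ (1+t J.^ h)
      Z₁ = c₁ (1+t J.^ h)
      Z₂ = c₂ (1+t J.^ h)

    -- Solves `c₂-sum` for `e`. Since `p = 2h + 1`, the factor `4h(h+1)` is `p^2 - 1`.
    24e : 24 ×′ 1# * e h (Pairing.b q h) ≈
          4 ×′ 1# * (h ×# 1#) * (h ×# 1# + 1#) * (suc n ×# 1#)
    24e = begin
      24 ×′ 1# * E
        -- The factor 24 is used as `12 * 2` on `h` choose 2 and, below, as `4 * 6` on `p` choose 3,
        -- matching the two denominator-free formulas.
        ≈⟨ solve 3 (λ Z N E → con (+ 24) :* E :=
             con (+ 24) :* (Z :* N :+ E) :- con (+ 12) :* ((con (+ 2) :* Z) :* N)) refl Z₂ N E ⟩
      24 ×′ 1# * (Z₂ * N + E) - 12 ×′ 1# * ((2 ×′ 1# * Z₂) * N)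
        ≈⟨ +-cong (*-congˡ (sym c₂-sum)) (-‿cong (*-congˡ (*-congʳ (2c₂-[1+t]^ h)))) ⟩
      24 ×′ 1# * Σ₂ - 12 ×′ 1# * ((H * (H - 1#)) * N)
        ≈⟨ +-congʳ (solve 1 (λ Σ₂ → con (+ 24) :* Σ₂ := con (+ 4) :* (con (+ 6) :* Σ₂)) refl Σ₂) ⟩
      4 ×′ 1# * (6 ×′ 1# * Σ₂) - 12 ×′ 1# * ((H * (H - 1#)) * N)
        ≈⟨ +-congʳ (*-congˡ (6c₂-sum-[1+t]^ (suc n))) ⟩
      4 ×′ 1# * (N * (N - 1#) * (N - 2 ×′ 1#)) - 12 ×′ 1# * ((H * (H - 1#)) * N)
        ≈⟨ +-congʳ (*-congˡ (*-cong (*-congˡ (+-congʳ N≈1+2H)) (+-congʳ N≈1+2H))) ⟩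
      4 ×′ 1# * (N * ((1# + (H + H)) - 1#) * ((1# + (H + H)) - 2 ×′ 1#)) - 12 ×′ 1# * ((H * (H - 1#)) * N)
        ≈⟨ solve 2 (λ H N →
             con (+ 4) :* (N :* ((:1 :+ (H :+ H)) :- :1) :* ((:1 :+ (H :+ H)) :- con (+ 2)))
               :- con (+ 12) :* ((H :* (H :- :1)) :* N) :=
             con (+ 4) :* H :* (H :+ :1) :* N) refl H N ⟩
      4 ×′ 1# * H * (H + 1#) * N
        ∎
      where
      open SetoidReasoning setoid
      H = h ×# 1#
      N = suc n ×# 1#
      E = e h (Pairing.b q h)
      Z₂ = c₂ (1+t J.^ h)
      Σ₂ = c₂ (J.sum {suc n} (λ i → 1+t J.^ toℕ i))
      N≈1+2H : N ≈ 1# + (H + H)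
      N≈1+2H = +-congˡ (×-homo-+ 1# h h)

-- The congruence modulo `P ^ 3` in a general ring

module Congruence {c ℓ} (A : CommutativeRing c ℓ) where

  open CommutativeRing A hiding (zero)
  open import Algebra.Definitions.RawSemiring (Semiring.rawSemiring semiring)
    using (_^_; sum; product; _∣_; _×′_) renaming (_×_ to _×#_)
  open IntegerSolver A
  open Products A
  open Units A using (geometric)

  -- The quotient keeps the carrier, so the projection is the identity function. As a homomorphism
  -- it identifies the powers, sums and products formed in the two rings.
  id-homo : ∀ P → IsRingHomomorphism rawRing (CommutativeRing.rawRing (Quotient.quotient A P)) (λ f → f)
  id-homo P = record
    { isSemiringHomomorphism = record
      { isNearSemiringHomomorphism = record
        { +-isMonoidHomomorphism = record
          { isMagmaHomomorphism = record
            { isRelHomomorphism = record { cong = ≈⇒≡P }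
            ; homo = λ _ _ → ≈⇒≡P refl
            }
          ; ε-homo = ≈⇒≡P refl
          }
        ; *-homo = λ _ _ → ≈⇒≡P refl
        }
      ; 1#-homo = ≈⇒≡P refl
      }
    ; -‿homo = λ _ → ≈⇒≡P refl
    }
    where open Quotient A P

  module _ (q : Carrier) (h : ℕ) (p-prime : Prime (suc (h ℕ.+ h)))
    (p-unit : suc (h ℕ.+ h) ×# 1# ∣ 1#) (24-unit : 24 ×′ 1# ∣ 1#) where

    p : ℕ
    p = suc (h ℕ.+ h)

    open Pairing q h

    P : Carrier
    P = sum {p} (λ i → q ^ toℕ i)

    open Quotient A P

    module id = Homomorphisms A quotient (id-homo P)
    private module QR = CommutativeRing quotient
    module Q where
      open CommutativeRing quotient public
      open RawSemiringDefinitions (Semiring.rawSemiring QR.semiring) public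
        using (_^_; sum; _∣_) renaming (_×_ to _×#_)
      module Sum = CommutativeMonoidSum QR.+-commutativeMonoid
      open Units quotient public

    Φ≡0 : Q.sum {p} (λ i → q Q.^ toℕ i) ≡P 0#
    Φ≡0 = Q.trans (Q.sym (id.sum-homo p (id.^-homo q)))
      (mod (1# , solve 1 (λ P → :1 :* P := P :- :0) refl P))

    p-unitQ : (p Q.×# 1#) Q.∣ 1#
    p-unitQ = let u , u*p≈1 = p-unit in u ,
      Q.trans (Q.*-congˡ {u} (Q.sym (id.×1-homo p))) (≈⇒≡P u*p≈1)

    open Q.Cyclotomic p-prime Φ≡0 p-unitQ
    open SymmetricFunction quotient using (24e)

    -- The quotient of `1 - q^(pk)` by `1 - q^p`.
    geometric-sum : ℕ → Carrier
    geometric-sum k = sum {k} (λ i → (q ^ p) ^ toℕ i)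

    geometric-sum≡k : ∀ k → geometric-sum k ≡P k Q.×# 1#
    geometric-sum≡k k = Q.trans (id.sum-homo k (id.^-homo (q ^ p)))
      (Q.trans (Q.Sum.sum-cong-≋ {k} {λ i → (q ^ p) Q.^ toℕ i}
                  (λ i → Q.1^n≈1 (toℕ i) (Q.trans (id.^-homo q p) q^p≈1)))
               (Q.Sum.sum-replicate k))

    [q^p]^k≡1 : ∀ k → (q ^ p) ^ k ≡P 1#
    [q^p]^k≡1 k = Q.trans (id.^-homo (q ^ p) k) (Q.1^n≈1 k (Q.trans (id.^-homo q p) q^p≈1))

    -- `κ` stands for the constant `m(m+1)(p^2-1)p/24`, described through its multiple by 24 so that
    -- no rational numbers enter the ring argument.
    module _ (m : ℕ) (κ : Carrier)
      (24κ : 24 ×′ 1# * κ ≈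
             4 ×′ 1# * (h ×# 1#) * (h ×# 1# + 1#) * (p ×# 1#) * (m ×# 1# * (1# + m ×# 1#)))
      where

      x : Carrier
      x = (q ^ p) ^ m

      eₕ : Carrier
      eₕ = e h b

      g g′ Y F₁ : Carrier
      g = geometric-sum m
      g′ = geometric-sum (suc m)
      Y = x ^ (h ∸ 1) * eₕ
      F₁ = product {h ℕ.+ h} (λ i → 1# - q * q ^ toℕ i)

      D≡0 : D x ≡P 0#
      D≡0 = Q.trans (Q.*-congʳ {1# - x * q ^ p} (Q.+-congˡ {1#} (Q.-‿cong ([q^p]^k≡1 m))))
        (≈⇒≡P (solve 1 (λ Z → (:1 :- :1) :* Z := :0) refl (1# - x * q ^ p)))

      -- Primality of `p` enters here, through the units `1 - q^k` that the evaluation of `e` in the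
      -- quotient requires.
      24e≡ : 24 ×′ 1# * eₕ ≡P 4 ×′ 1# * (h ×# 1#) * (h ×# 1# + 1#) * (p ×# 1#)
      24e≡ = Q.trans (Q.*-congˡ {24 ×′ 1#} (id.e-homo h (id.b-homo q h)))
        (Q.trans (24e q h q^p≈1 λ k<n → 1-q^k∣1 (ℕ.s≤s k<n))
        (Q.sym (Q.*-cong (Q.*-cong (Q.*-congˡ {4 ×′ 1#} (id.×1-homo h))
          (Q.+-congʳ {1#} (id.×1-homo h))) (id.×1-homo p))))

      -- This is the cofactor left once `D x` has given up `(1 - q)^2 P^2`, so knowing it modulo `P`
      -- settles the matter modulo `P ^ 3`. Modulo `P`, `g` is `m`, `g′` is `m + 1`, `x` is 1 and
      -- `D x` is 0, which leaves `m(m+1) e` whatever `r` is.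
      gg′[Y+Dr]≡κ : ∀ r → g * g′ * (Y + D x * r) ≡P κ
      gg′[Y+Dr]≡κ r = let v , v*24≈1 = 24-unit in begin
        g * g′ * (Y + D x * r)
          ≈⟨ Q.*-cong (Q.*-cong (Q.trans (geometric-sum≡k m) (Q.sym (id.×1-homo m)))
               (Q.trans (geometric-sum≡k (suc m)) (Q.sym (id.×1-homo (suc m)))))
               (Q.+-cong (Q.*-congʳ {eₕ} (Q.trans (id.^-homo x (h ∸ 1)) (Q.1^n≈1 (h ∸ 1) ([q^p]^k≡1 m))))
                         (Q.*-congʳ {r} D≡0)) ⟩
        M * (1# + M) * (1# * eₕ + 0# * r)
          ≈⟨ ≈⇒≡P (solve 3 (λ M E r → M :* (:1 :+ M) :* (:1 :* E :+ :0 :* r) :=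
               :1 :* (M :* (:1 :+ M) :* E)) refl M eₕ r) ⟩
        1# * (M * (1# + M) * eₕ)
          -- The value of `e` is known only up to the factor 24, so 1 is expanded as `v * 24`.
          ≈⟨ ≈⇒≡P (*-congʳ (sym v*24≈1)) ⟩
        v * 24 ×′ 1# * (M * (1# + M) * eₕ)
          ≈⟨ ≈⇒≡P (solve 3 (λ v M E → v :* con (+ 24) :* (M :* (:1 :+ M) :* E) :=
               v :* ((con (+ 24) :* E) :* (M :* (:1 :+ M)))) refl v M eₕ) ⟩
        v * ((24 ×′ 1# * eₕ) * (M * (1# + M)))
          ≈⟨ Q.*-congˡ {v} (Q.*-congʳ {M * (1# + M)} 24e≡) ⟩
        v * (4 ×′ 1# * (h ×# 1#) * (h ×# 1# + 1#) * (p ×# 1#) * (M * (1# + M)))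
          ≈⟨ ≈⇒≡P (trans (*-congˡ (sym 24κ))
               (trans (sym (*-assoc _ _ _)) (trans (*-congʳ v*24≈1) (*-identityˡ κ)))) ⟩
        κ
          ∎
        where
        open SetoidReasoning Q.setoid
        M = m ×# 1#

      -- Both factors of `D x` have the form `1 - q^(pk)`, with `k = m` and `k = m + 1`, and each is
      -- a multiple of `1 - q^p`, which is `P * (1# - q)`.
      D≈P² : D x ≈ (g * (P * (1# - q))) * (g′ * (P * (1# - q)))
      D≈P² = *-cong (factor m) (trans (+-congˡ (-‿cong (*-comm x (q ^ p)))) (factor (suc m)))
        where
        factor : ∀ k → 1# - (q ^ p) ^ k ≈ geometric-sum k * (P * (1# - q))
        factor k = trans (sym (geometric (q ^ p) k)) (*-congˡ (sym (geometric q p)))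

      congruence : P ^ 3 ∣ (product {h ℕ.+ h} (λ i → 1# - x * q * q ^ toℕ i) - x ^ h * F₁)
                           - κ * (1# - q) ^ 2 * P ^ 2
      congruence = let r , eq = product-expand h b x (D x); mod (w , wP≈) = gg′[Y+Dr]≡κ r in
        -- `w` is the quotient by `P` of the cofactor minus `κ`; multiplying by `(1 - q)^2 P^2`
        -- restores the second-order part of the product.
        w * (1# - q) ^ 2 , (begin
          w * (1# - q) ^ 2 * P ^ 3
            ≈⟨ solve 3 (λ w P t → w :* (t :* (t :* :1)) :* (P :* (P :* (P :* :1))) :=
                 (w :* P) :* ((t :* (t :* :1)) :* (P :* (P :* :1)))) refl w P (1# - q) ⟩
          (w * P) * ((1# - q) ^ 2 * P ^ 2)
            ≈⟨ *-congʳ wP≈ ⟩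
          (g * g′ * (Y + D x * r) - κ) * ((1# - q) ^ 2 * P ^ 2)
            ≈⟨ solve 6 (λ g g′ Z κ P t →
                 (g :* g′ :* Z :- κ) :* ((t :* (t :* :1)) :* (P :* (P :* :1))) :=
                 ((g :* (P :* t)) :* (g′ :* (P :* t))) :* Z :- κ :* (t :* (t :* :1)) :* (P :* (P :* :1)))
                 refl g g′ (Y + D x * r) κ P (1# - q) ⟩
          ((g * (P * (1# - q))) * (g′ * (P * (1# - q)))) * (Y + D x * r) - K
            ≈⟨ +-congʳ (*-congʳ D≈P²) ⟨
          D x * (Y + D x * r) - K
            ≈⟨ +-congʳ (solve 2 (λ a b → a := (b :+ a) :- b) refl (D x * (Y + D x * r)) (x ^ h * F₁)) ⟩
          ((x ^ h * F₁ + D x * (Y + D x * r)) - x ^ h * F₁) - K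
            ≈⟨ +-congʳ (+-congʳ (trans (product-1-xq x) (trans eq (+-congʳ (*-congˡ (sym product-1-q)))))) ⟨
          (product {h ℕ.+ h} (λ i → 1# - x * q * q ^ toℕ i) - x ^ h * F₁) - K
            ∎)
        where
        open SetoidReasoning setoid
        K = κ * (1# - q) ^ 2 * P ^ 2

-- Specialisation to rational polynomials

open import Defs

private
  module ℚ[q] = CommutativeRing ℚ[q]-commutativeRing

open Congruence ℚ[q]-commutativeRing using (congruence)
open RawSemiringDefinitions (Semiring.rawSemiring ℚ[q].semiring) using (_×′_)
  renaming (_×_ to _×#_)
open import Algebra.Properties.Semiring.Mult ℚ[q].semiring using (×-homo-+; ×1-homo-*)
open import Algebra.Properties.Semiring.Mult.TCOptimised ℚ[q].semiring using (×ᵤ≈×)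
open import Algebra.Properties.Semiring.Exp ℚ[q].semiring using (^-homo-*; ^-assocʳ; ^-congʳ; ^-congˡ)
open import Algebra.Properties.Semiring.Divisibility ℚ[q].semiring using (∣ʳ-respʳ-≈)
import Algebra.Properties.CommutativeMonoid.Sum ℚ[q].*-commutativeMonoid as Product

odd : ∀ p → 2 ℕ.∤ p → ∃ λ h → p ≡ suc (h ℕ.+ h)
odd zero          2∤p = contradiction (2 ℕ.∣0) 2∤p
odd (suc zero)    2∤p = 0 , ≡.refl
odd (suc (suc p)) 2∤p with h , p≡1+2h ← odd p (λ 2∣p → 2∤p (ℕ.∣m∣n⇒∣m+n ℕ.∣-refl 2∣p)) =
  suc h , ≡.cong suc (≡.trans (≡.cong suc p≡1+2h) (≡.cong suc (≡.sym (ℕ.+-suc h h))))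

-- Checked on unnormalised fractions, where addition does not reduce to lowest terms.
1+n/1 : ∀ n → 1ℚ ℚ.+ + n ℚ./ 1 ≡ + suc n ℚ./ 1
1+n/1 n = ℚ.toℚᵘ-injective (begin
  ℚ.toℚᵘ (1ℚ ℚ.+ + n ℚ./ 1)            ≈⟨ ℚ.toℚᵘ-homo-+ 1ℚ (+ n ℚ./ 1) ⟩
  ℚ.toℚᵘ 1ℚ ℚᵘ.+ ℚ.toℚᵘ (+ n ℚ./ 1)    ≈⟨ ℚᵘ.+-congʳ (ℚ.toℚᵘ 1ℚ) (ℚ.toℚᵘ-fromℚᵘ (mkℚᵘ (+ n) 0)) ⟩
  ℚ.toℚᵘ 1ℚ ℚᵘ.+ mkℚᵘ (+ n) 0          ≈⟨ *≡* (≡.cong (λ k → (+ 1 ℤ.+ k) ℤ.* + 1) (ℤ.*-identityʳ (+ n))) ⟩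
  mkℚᵘ (+ suc n) 0                     ≈⟨ ℚ.toℚᵘ-fromℚᵘ (mkℚᵘ (+ suc n) 0) ⟨
  ℚ.toℚᵘ (+ suc n ℚ./ 1)               ∎)
  where open SetoidReasoning ℚᵘ.≃-setoid

d/1*n/d : ∀ d n → (+ suc d ℚ./ 1) ℚ.* (+ n ℚ./ suc d) ≡ + n ℚ./ 1
d/1*n/d d n = ℚ.toℚᵘ-injective (begin
  ℚ.toℚᵘ ((+ suc d ℚ./ 1) ℚ.* (+ n ℚ./ suc d))
    ≈⟨ ℚ.toℚᵘ-homo-* (+ suc d ℚ./ 1) (+ n ℚ./ suc d) ⟩
  ℚ.toℚᵘ (+ suc d ℚ./ 1) ℚᵘ.* ℚ.toℚᵘ (+ n ℚ./ suc d)
    ≈⟨ ℚᵘ.*-cong (ℚ.toℚᵘ-fromℚᵘ (mkℚᵘ (+ suc d) 0)) (ℚ.toℚᵘ-fromℚᵘ (mkℚᵘ (+ n) d)) ⟩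
  mkℚᵘ (+ suc d) 0 ℚᵘ.* mkℚᵘ (+ n) d
    ≈⟨ *≡* (≡.trans (ℤ.*-identityʳ _) (≡.trans (ℤ.*-comm (+ suc d) (+ n))
         (≡.cong (λ k → + n ℤ.* + suc k) (≡.sym (ℕ.+-identityʳ d))))) ⟩
  mkℚᵘ (+ n) 0
    ≈⟨ ℚ.toℚᵘ-fromℚᵘ (mkℚᵘ (+ n) 0) ⟨
  ℚ.toℚᵘ (+ n ℚ./ 1)
    ∎)
  where open SetoidReasoning ℚᵘ.≃-setoid

const-cong : ∀ {a b} → a ≡ b → const a ≈ const b
const-cong a≡b = ∷-cong a≡b ℚ[q].refl

const-* : ∀ a b → const a * const b ≈ const (a ℚ.* b)
const-* a b = const-cong (ℚ.+-identityʳ (a ℚ.* b))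

×1≈const : ∀ n → n ×# 1# ≈ const (+ n ℚ./ 1)
×1≈const zero    = ℚ[q].sym 0∷0#
×1≈const (suc n) = ℚ[q].trans (+-cong {1#} ℚ[q].refl (×1≈const n)) (const-cong (1+n/1 n))

d*const[n/d] : ∀ d n → suc d ×# 1# * const (+ n ℚ./ suc d) ≈ n ×# 1#
d*const[n/d] d n = begin
  suc d ×# 1# * const (+ n ℚ./ suc d)              ≈⟨ *-cong (×1≈const (suc d)) (ℚ[q].refl {const (+ n ℚ./ suc d)}) ⟩
  const (+ suc d ℚ./ 1) * const (+ n ℚ./ suc d)    ≈⟨ const-* (+ suc d ℚ./ 1) (+ n ℚ./ suc d) ⟩
  const ((+ suc d ℚ./ 1) ℚ.* (+ n ℚ./ suc d))      ≈⟨ const-cong (d/1*n/d d n) ⟩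
  const (+ n ℚ./ 1)                                ≈⟨ ×1≈const n ⟨
  n ×# 1#                                          ∎
  where open SetoidReasoning ℚ[q].setoid

-- Rational coefficients provide the inverses of both `p` and 24.
×1-unit : ∀ d → suc d ×# 1# ∣ 1#
×1-unit d = const (+ 1 ℚ./ suc d) ,
  ℚ[q].trans (*-comm (const (+ 1 ℚ./ suc d)) (suc d ×# 1#))
    (ℚ[q].trans (d*const[n/d] d 1) (ℚ[q].+-identityʳ 1#))

24-unit : 24 ×′ 1# ∣ 1#
24-unit = let u , eq = ×1-unit 23 in u , ℚ[q].trans (*-cong {u} ℚ[q].refl (ℚ[q].sym (×ᵤ≈× 24 1#))) eq

numerator : ℕ → ℕ → ℕ
numerator m p = m ℕ.* (m ℕ.+ 1) ℕ.* (p ℕ.^ 2 ∸ 1) ℕ.* p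

-- Removes the truncated subtraction: for `p = 2h + 1` the square is `1 + 4h(h+1)`, from which `∸ 1`
-- computes.
numerator-odd : ∀ m h → let p = suc (h ℕ.+ h) in
  numerator m p ≡ 4 ℕ.* h ℕ.* (h ℕ.+ 1) ℕ.* p ℕ.* (m ℕ.* suc m)
numerator-odd m h = ≡.trans
  (≡.cong (λ k → m ℕ.* (m ℕ.+ 1) ℕ.* (k ∸ 1) ℕ.* suc (h ℕ.+ h))
    (solve 1 (λ h → (con 1 :+ (h :+ h)) :^ 2 := con 1 :+ con 4 :* h :* (h :+ con 1)) ≡.refl h))
  (solve 2 (λ m h → m :* (m :+ con 1) :* (con 4 :* h :* (h :+ con 1)) :* (con 1 :+ (h :+ h)) :=
    con 4 :* h :* (h :+ con 1) :* (con 1 :+ (h :+ h)) :* (m :* (con 1 :+ m))) ≡.refl m h)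
  where open +-*-Solver

24κ : ∀ m h → let p = suc (h ℕ.+ h) in
  24 ×′ 1# * const (+ numerator m p ℚ./ 24) ≈
  4 ×′ 1# * (h ×# 1#) * (h ×# 1# + 1#) * (p ×# 1#) * (m ×# 1# * (1# + m ×# 1#))
24κ m h = begin
  24 ×′ 1# * κ
    ≈⟨ ℚ[q].*-congʳ {κ} (×ᵤ≈× 24 1#) ⟨
  24 ×# 1# * κ
    ≈⟨ d*const[n/d] 23 (numerator m p) ⟩
  numerator m p ×# 1#
    ≡⟨ ≡.cong (_×# 1#) (numerator-odd m h) ⟩
  (4 ℕ.* h ℕ.* (h ℕ.+ 1) ℕ.* p ℕ.* (m ℕ.* suc m)) ×# 1#
    ≈⟨ ×1-homo-* (4 ℕ.* h ℕ.* (h ℕ.+ 1) ℕ.* p) (m ℕ.* suc m) ⟩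
  (4 ℕ.* h ℕ.* (h ℕ.+ 1) ℕ.* p) ×# 1# * (m ℕ.* suc m) ×# 1#
    ≈⟨ *-cong (×1-homo-* (4 ℕ.* h ℕ.* (h ℕ.+ 1)) p) (×1-homo-* m (suc m)) ⟩
  (4 ℕ.* h ℕ.* (h ℕ.+ 1)) ×# 1# * (p ×# 1#) * (m ×# 1# * (suc m ×# 1#))
    ≈⟨ ℚ[q].*-congʳ {m ×# 1# * (suc m ×# 1#)} (ℚ[q].*-congʳ {p ×# 1#}
         (ℚ[q].trans (×1-homo-* (4 ℕ.* h) (h ℕ.+ 1))
           (*-cong (ℚ[q].trans (×1-homo-* 4 h) (ℚ[q].*-congʳ {h ×# 1#} (×ᵤ≈× 4 1#)))
             (ℚ[q].trans (×-homo-+ 1# h 1) (ℚ[q].+-congˡ {h ×# 1#} (ℚ[q].+-identityʳ 1#)))))) ⟩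
  4 ×′ 1# * (h ×# 1#) * (h ×# 1# + 1#) * (p ×# 1#) * (m ×# 1# * (1# + m ×# 1#))
    ∎
  where
  open SetoidReasoning ℚ[q].setoid
  p = suc (h ℕ.+ h)
  κ = const (+ numerator m p ℚ./ 24)

-- Since `p - 1` is `h + h`, the division in the exponent `mp(p-1)/2` is exact.
k[h+h]/2 : ∀ k h → k ℕ.* (h ℕ.+ h) ℕ./ 2 ≡ k ℕ.* h
k[h+h]/2 k h = ≡.trans
  (≡.cong (ℕ._/ 2) (solve 2 (λ k h → k :* (h :+ h) := k :* h :* con 2) ≡.refl k h))
  (m*n/n≡m (k ℕ.* h) 2)
  where open +-*-Solver

theorem2-odd : ∀ h m → let p = suc (h ℕ.+ h) in Prime p →
    ⟨ q ^ (m ℕ.* p ℕ.+ 1) ⨾q⟩ (p ∸ 1) - q ^ (m ℕ.* p ℕ.* (p ∸ 1) ℕ./ 2) * ⟨ q ⨾q⟩ (p ∸ 1)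
    ≡ const (+ (m ℕ.* (m ℕ.+ 1) ℕ.* (p ℕ.^ 2 ∸ 1) ℕ.* p) ℚ./ 24) * (1# - q) ^ 2 * [ p ]q ^ 2
    [mod [ p ]q ^ 3 ]
-- `congruence` is the claim written with `x = q^(mp)`. What remains is to match `q^(mp+1)` with
-- `x * q` and `q^(mp(p-1)/2)` with `x ^ h`.
theorem2-odd h m p-prime = ∣ʳ-respʳ-≈ (ℚ[q].+-congʳ {ℚ[q].- K} (+-cong
    (Product.sum-cong-≋ {h ℕ.+ h} {λ i → 1# - x * q * q ^ toℕ i} λ i →
      ℚ[q].+-congˡ {1#} (-‿cong (ℚ[q].*-congʳ {q ^ toℕ i} (ℚ[q].sym q^[mp+1]≈xq))))
    (-‿cong (ℚ[q].*-congʳ {⟨ q ⨾q⟩ (h ℕ.+ h)} (ℚ[q].sym q^[mp[p-1]/2]≈x^h)))))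
  (congruence q h p-prime (×1-unit (h ℕ.+ h)) 24-unit m (const (+ numerator m p ℚ./ 24)) (24κ m h))
  where
  p = suc (h ℕ.+ h)
  x = (q ^ p) ^ m
  K = const (+ numerator m p ℚ./ 24) * (1# - q) ^ 2 * [ p ]q ^ 2
  open SetoidReasoning ℚ[q].setoid
  q^[mp]≈x : q ^ (m ℕ.* p) ≈ x
  q^[mp]≈x = ℚ[q].trans (^-congʳ q (ℕ.*-comm m p)) (ℚ[q].sym (^-assocʳ q p m))
  q^[mp+1]≈xq : q ^ (m ℕ.* p ℕ.+ 1) ≈ x * q
  q^[mp+1]≈xq = ℚ[q].trans (^-homo-* q (m ℕ.* p) 1) (*-cong q^[mp]≈x (*-identityʳ q))
  q^[mp[p-1]/2]≈x^h : q ^ (m ℕ.* p ℕ.* (h ℕ.+ h) ℕ./ 2) ≈ x ^ h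
  q^[mp[p-1]/2]≈x^h = begin
    q ^ (m ℕ.* p ℕ.* (h ℕ.+ h) ℕ./ 2)  ≈⟨ ^-congʳ q (k[h+h]/2 (m ℕ.* p) h) ⟩
    q ^ (m ℕ.* p ℕ.* h)                ≈⟨ ^-assocʳ q (m ℕ.* p) h ⟨
    (q ^ (m ℕ.* p)) ^ h                ≈⟨ ^-congˡ h q^[mp]≈x ⟩
    x ^ h                              ∎

theorem2 : (p m : ℕ) → Prime p → 2 ℕ.∤ p → 1 ℕ.≤ m →
    ⟨ q ^ (m ℕ.* p ℕ.+ 1) ⨾q⟩ (p ∸ 1) - q ^ (m ℕ.* p ℕ.* (p ∸ 1) ℕ./ 2) * ⟨ q ⨾q⟩ (p ∸ 1)
    ≡ const (+ (m ℕ.* (m ℕ.+ 1) ℕ.* (p ℕ.^ 2 ∸ 1) ℕ.* p) ℚ./ 24) * (1# - q) ^ 2 * [ p ]q ^ 2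
    [mod [ p ]q ^ 3 ]
theorem2 p m p-prime 2∤p _ with h , ≡.refl ← odd p 2∤p = theorem2-odd h m p-prime
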